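{- Let $$f_{s,t}(x)=\mathrm{cosb}_s(x)+\int_0^x \mathrm{cosb}_t(y)\,dy=\sum_{k\ge0}a_k\frac{x^k}{k!},$$ and for $n\ge1$ put $\bar n=\lceil n/2\rceil$, $\underline n=\lfloor n/2\rfloor$. Then, as an identity of rational functions of $(s,t)$, $$\det(a_{2i+j})_{0\le i,j\le n-1} =(-1)^{\binom{\bar n}2}\, \frac{\prod_{i=0}^{n-1}(2i)!}{2^{\,n(n-1)}}\, \Bigl(\prod_{l=0}^{\bar n-1}\frac{(s+\tfrac12)_l}{(s+1)_{n-1+l}}\Bigr) \Bigl(\prod_{m=0}^{\underline n-1}\frac{(t+\tfrac12)_m}{(t+1)_{n-1+m}}\Bigr) \prod_{r=1}^{\bar n}\prod_{c=1}^{\underline n}\frac{t-s+c-r}{n-r-c+1}\,.$$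
   Context: $\mathrm{cosb}_s$ is the normalised Bessel function $\mathrm{cosb}_s(x)=\Gamma(s+1)(2/x)^sJ_s(x)=\sum_{k\ge0}\frac{(-1)^k}{4^k\,k!\,(s+1)_k}x^{2k}$, viewed as a power series in $x$ with coefficients in $\mathbb Q(s)$; consequently $a_{2k}=(-1)^k(\tfrac12)_k/(s+1)_k$ and $a_{2k+1}=(-1)^k(\tfrac12)_k/(t+1)_k$. $(\gamma)_m=\gamma(\gamma+1)\cdots(\gamma+m-1)$ is the Pochhammer symbol; empty products equal $1$. -}

module Defs where

open import Algebra.Bundles using (CommutativeRing; Semiring)
import Algebra.Definitions.RawMonoid as RawMonoidOps
import Algebra.Definitions.RawSemiring as RawSemiringOps
import Algebra.Properties.Ring as RingProperties
import Algebra.Solver.Ring.NaturalCoefficients.Default as SemiringSolver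
open import Data.Fin.Base using (Fin; zero; suc; toℕ; punchIn)
open import Data.List.Base using (List; []; _∷_; map)
open import Data.Nat.Base as ℕ using (ℕ; zero; suc; _!; ⌊_/2⌋; ⌈_/2⌉)
open import Data.Nat.Combinatorics using (_C_)
open import Data.Product.Base using (_,_)
open import Data.Rational.Base using (ℚ)
import Data.Rational.Base as ℚ
import Data.Rational.Properties as ℚ
open import Data.Sum.Base using (_⊎_; inj₁; inj₂; [_,_]′)
import Data.Sum.Base as Sum
open import Level using (Level; _⊔_; 0ℓ) renaming (suc to lsuc)
open import Relation.Binary.Bundles using (Setoid)
open import Relation.Binary.Definitions using (Decidable)
import Relation.Binary.PropositionalEquality as ≡
import Relation.Binary.Reasoning.Setoid as SetoidReasoning
open import Relation.Nullary.Decidable using (Dec; yes; no; map′; _×-dec_)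
open import Relation.Nullary.Negation using (¬_; contradiction)

record IntegralDomain (c ℓ : Level) : Set (lsuc (c ⊔ ℓ)) where
  field
    commutativeRing : CommutativeRing c ℓ
  open CommutativeRing commutativeRing public
  field
    _≈?_           : Decidable _≈_
    1≉0            : ¬ (1# ≈ 0#)
    noZeroDivisors : ∀ {x y} → x * y ≈ 0# → x ≈ 0# ⊎ y ≈ 0#

-- A field with decidable equality. The inverse is a total operation, with the
-- usual convention 0⁻¹ = 0; below, over ℚ(s,t), it is only ever applied to
-- nonzero elements.
record Field (c ℓ : Level) : Set (lsuc (c ⊔ ℓ)) where
  field
    commutativeRing : CommutativeRing c ℓ
  open CommutativeRing commutativeRing public
  infix  8 _⁻¹
  infixl 7 _/_
  field
    _≈?_       : Decidable _≈_
    1≉0        : ¬ (1# ≈ 0#)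
    _⁻¹        : Carrier → Carrier
    ⁻¹-cong    : ∀ {x y} → x ≈ y → x ⁻¹ ≈ y ⁻¹
    *-inverseʳ : ∀ {x} → ¬ (x ≈ 0#) → x * x ⁻¹ ≈ 1#
    0⁻¹≈0      : 0# ⁻¹ ≈ 0#

  _/_ : Carrier → Carrier → Carrier
  x / y = x * y ⁻¹

-- The list a₀ ∷ a₁ ∷ … ∷ [] stands for a₀ + a₁X + …; trailing zeros are
-- identified by the equality _≋_.
module Polynomials {c ℓ : Level} (R : CommutativeRing c ℓ) where
  open CommutativeRing R
  open RingProperties ring using (-0#≈0#)

  Poly : Set c
  Poly = List Carrier

  coeff : Poly → ℕ → Carrier
  coeff []      _       = 0#
  coeff (a ∷ p) zero    = a
  coeff (a ∷ p) (suc n) = coeff p n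

  infix 4 _≋_
  record _≋_ (p q : Poly) : Set ℓ where
    constructor mk≋
    field
      at : ∀ n → coeff p n ≈ coeff q n
  open _≋_ public

  infixl 6 _⊕_
  _⊕_ : Poly → Poly → Poly
  []      ⊕ q       = q
  (a ∷ p) ⊕ []      = a ∷ p
  (a ∷ p) ⊕ (b ∷ q) = (a + b) ∷ (p ⊕ q)

  ⊖_ : Poly → Poly
  ⊖_ = map (-_)

  infixr 7 _·_
  _·_ : Carrier → Poly → Poly
  a · p = map (a *_) p

  infixl 7 _⊛_
  _⊛_ : Poly → Poly → Poly
  []      ⊛ q = []
  (a ∷ p) ⊛ q = (a · q) ⊕ (0# ∷ (p ⊛ q))

  const : Carrier → Poly
  const a = a ∷ []

  𝟘 𝟙 X : Poly
  𝟘 = []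
  𝟙 = const 1#
  X = 0# ∷ 1# ∷ []

  ≋-setoid : Setoid c ℓ
  ≋-setoid = record
    { Carrier = Poly
    ; _≈_ = _≋_
    ; isEquivalence = record
      { refl  = mk≋ λ _ → refl
      ; sym   = λ e → mk≋ λ n → sym (at e n)
      ; trans = λ e f → mk≋ λ n → trans (at e n) (at f n)
      }
    }
  open Setoid ≋-setoid using ()
    renaming (refl to ≋-refl; sym to ≋-sym; trans to ≋-trans)

  coeff-⊕ : ∀ p q n → coeff (p ⊕ q) n ≈ coeff p n + coeff q n
  coeff-⊕ []      q       n       = sym (+-identityˡ _)
  coeff-⊕ (a ∷ p) []      n       = sym (+-identityʳ _)
  coeff-⊕ (a ∷ p) (b ∷ q) zero    = refl
  coeff-⊕ (a ∷ p) (b ∷ q) (suc n) = coeff-⊕ p q n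

  coeff-⊖ : ∀ p n → coeff (⊖ p) n ≈ - coeff p n
  coeff-⊖ []      n       = sym -0#≈0#
  coeff-⊖ (a ∷ p) zero    = refl
  coeff-⊖ (a ∷ p) (suc n) = coeff-⊖ p n

  coeff-· : ∀ a p n → coeff (a · p) n ≈ a * coeff p n
  coeff-· a []      n       = sym (zeroʳ a)
  coeff-· a (b ∷ p) zero    = refl
  coeff-· a (b ∷ p) (suc n) = coeff-· a p n

  ∷-cong : ∀ {a b p q} → a ≈ b → p ≋ q → a ∷ p ≋ b ∷ q
  ∷-cong e f = mk≋ λ { zero → e ; (suc n) → at f n }

  0∷[] : 0# ∷ [] ≋ []
  0∷[] = mk≋ λ { zero → refl ; (suc n) → refl }

  ⊕-cong : ∀ {p p′ q q′} → p ≋ p′ → q ≋ q′ → p ⊕ q ≋ p′ ⊕ q′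
  ⊕-cong {p} {p′} {q} {q′} e f = mk≋ λ n →
    trans (coeff-⊕ p q n) (trans (+-cong (at e n) (at f n)) (sym (coeff-⊕ p′ q′ n)))

  ⊕-comm : ∀ p q → p ⊕ q ≋ q ⊕ p
  ⊕-comm p q = mk≋ λ n →
    trans (coeff-⊕ p q n) (trans (+-comm _ _) (sym (coeff-⊕ q p n)))

  ⊕-assoc : ∀ p q r → (p ⊕ q) ⊕ r ≋ p ⊕ (q ⊕ r)
  ⊕-assoc p q r = mk≋ λ n → begin
    coeff ((p ⊕ q) ⊕ r) n                 ≈⟨ coeff-⊕ (p ⊕ q) r n ⟩
    coeff (p ⊕ q) n + coeff r n           ≈⟨ +-congʳ (coeff-⊕ p q n) ⟩
    (coeff p n + coeff q n) + coeff r n   ≈⟨ +-assoc _ _ _ ⟩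
    coeff p n + (coeff q n + coeff r n)   ≈⟨ +-congˡ (coeff-⊕ q r n) ⟨
    coeff p n + coeff (q ⊕ r) n           ≈⟨ coeff-⊕ p (q ⊕ r) n ⟨
    coeff (p ⊕ (q ⊕ r)) n                 ∎
    where open SetoidReasoning setoid

  ⊕-exchange : ∀ p q r → p ⊕ (q ⊕ r) ≋ q ⊕ (p ⊕ r)
  ⊕-exchange p q r = begin
    p ⊕ (q ⊕ r) ≈⟨ ⊕-assoc p q r ⟨
    (p ⊕ q) ⊕ r ≈⟨ ⊕-cong (⊕-comm p q) ≋-refl ⟩
    (q ⊕ p) ⊕ r ≈⟨ ⊕-assoc q p r ⟩
    q ⊕ (p ⊕ r) ∎
    where open SetoidReasoning ≋-setoid

  ⊕-identityʳ : ∀ p → p ⊕ [] ≋ p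
  ⊕-identityʳ p = ⊕-comm p []

  ⊖-cong : ∀ {p q} → p ≋ q → ⊖ p ≋ ⊖ q
  ⊖-cong {p} {q} e = mk≋ λ n →
    trans (coeff-⊖ p n) (trans (-‿cong (at e n)) (sym (coeff-⊖ q n)))

  ⊖-inverseˡ : ∀ p → (⊖ p) ⊕ p ≋ []
  ⊖-inverseˡ p = mk≋ λ n →
    trans (coeff-⊕ (⊖ p) p n) (trans (+-congʳ (coeff-⊖ p n)) (-‿inverseˡ _))

  ⊖-inverseʳ : ∀ p → p ⊕ (⊖ p) ≋ []
  ⊖-inverseʳ p = ≋-trans (⊕-comm p (⊖ p)) (⊖-inverseˡ p)

  ·-cong : ∀ {a b p q} → a ≈ b → p ≋ q → a · p ≋ b · q
  ·-cong {a} {b} {p} {q} e f = mk≋ λ n →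
    trans (coeff-· a p n) (trans (*-cong e (at f n)) (sym (coeff-· b q n)))

  ·-distrib-⊕ : ∀ a p q → a · (p ⊕ q) ≋ (a · p) ⊕ (a · q)
  ·-distrib-⊕ a p q = mk≋ λ n → begin
    coeff (a · (p ⊕ q)) n               ≈⟨ coeff-· a (p ⊕ q) n ⟩
    a * coeff (p ⊕ q) n                 ≈⟨ *-congˡ (coeff-⊕ p q n) ⟩
    a * (coeff p n + coeff q n)         ≈⟨ distribˡ _ _ _ ⟩
    a * coeff p n + a * coeff q n       ≈⟨ +-cong (coeff-· a p n) (coeff-· a q n) ⟨
    coeff (a · p) n + coeff (a · q) n   ≈⟨ coeff-⊕ (a · p) (a · q) n ⟨
    coeff ((a · p) ⊕ (a · q)) n         ∎
    where open SetoidReasoning setoid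

  ·-assoc : ∀ a b p → (a * b) · p ≋ a · (b · p)
  ·-assoc a b p = mk≋ λ n → begin
    coeff ((a * b) · p) n   ≈⟨ coeff-· (a * b) p n ⟩
    a * b * coeff p n       ≈⟨ *-assoc _ _ _ ⟩
    a * (b * coeff p n)     ≈⟨ *-congˡ (coeff-· b p n) ⟨
    a * coeff (b · p) n     ≈⟨ coeff-· a (b · p) n ⟨
    coeff (a · (b · p)) n   ∎
    where open SetoidReasoning setoid

  0·≋[] : ∀ {a} p → a ≈ 0# → a · p ≋ []
  0·≋[] {a} p e = mk≋ λ n → trans (coeff-· a p n) (trans (*-congʳ e) (zeroˡ _))

  1·≋ : ∀ p → 1# · p ≋ p
  1·≋ p = mk≋ λ n → trans (coeff-· 1# p n) (*-identityˡ _)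

  ⊛-zeroʳ : ∀ p → p ⊛ [] ≋ []
  ⊛-zeroʳ []      = ≋-refl
  ⊛-zeroʳ (a ∷ p) = ≋-trans (∷-cong refl (⊛-zeroʳ p)) 0∷[]

  ⊛-∷ : ∀ p b q → p ⊛ (b ∷ q) ≋ (b · p) ⊕ (0# ∷ (p ⊛ q))
  ⊛-∷ []      b q = ≋-sym 0∷[]
  ⊛-∷ (a ∷ p) b q = ∷-cong (+-congʳ (*-comm a b))
    (≋-trans (⊕-cong ≋-refl (⊛-∷ p b q)) (⊕-exchange (a · q) (b · p) _))

  ⊛-comm : ∀ p q → p ⊛ q ≋ q ⊛ p
  ⊛-comm []      q = ≋-sym (⊛-zeroʳ q)
  ⊛-comm (a ∷ p) q = ≋-trans
    (⊕-cong ≋-refl (∷-cong refl (⊛-comm p q))) (≋-sym (⊛-∷ q a p))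

  ⊛-congˡ : ∀ p {q q′} → q ≋ q′ → p ⊛ q ≋ p ⊛ q′
  ⊛-congˡ []      e = ≋-refl
  ⊛-congˡ (a ∷ p) e = ⊕-cong (·-cong refl e) (∷-cong refl (⊛-congˡ p e))

  ⊛-congʳ : ∀ {p p′} q → p ≋ p′ → p ⊛ q ≋ p′ ⊛ q
  ⊛-congʳ {p} {p′} q e =
    ≋-trans (⊛-comm p q) (≋-trans (⊛-congˡ q e) (⊛-comm q p′))

  ⊛-cong : ∀ {p p′ q q′} → p ≋ p′ → q ≋ q′ → p ⊛ q ≋ p′ ⊛ q′
  ⊛-cong {p} {p′} {q} {q′} e f = ≋-trans (⊛-congʳ q e) (⊛-congˡ p′ f)

  ⊛-distribˡ : ∀ p q r → p ⊛ (q ⊕ r) ≋ (p ⊛ q) ⊕ (p ⊛ r)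
  ⊛-distribˡ []      q r = ≋-refl
  ⊛-distribˡ (a ∷ p) q r = begin
    a · (q ⊕ r) ⊕ (0# ∷ p ⊛ (q ⊕ r))
      ≈⟨ ⊕-cong (·-distrib-⊕ a q r)
                (∷-cong (sym (+-identityˡ 0#)) (⊛-distribˡ p q r)) ⟩
    (a · q ⊕ a · r) ⊕ (pq ⊕ pr)
      ≈⟨ ⊕-assoc (a · q) (a · r) _ ⟩
    a · q ⊕ (a · r ⊕ (pq ⊕ pr))
      ≈⟨ ⊕-cong {a · q} ≋-refl (⊕-exchange (a · r) pq pr) ⟩
    a · q ⊕ (pq ⊕ (a · r ⊕ pr))
      ≈⟨ ⊕-assoc (a · q) pq _ ⟨
    (a · q ⊕ pq) ⊕ (a · r ⊕ pr) ∎
    where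
    open SetoidReasoning ≋-setoid
    pq pr : Poly
    pq = 0# ∷ p ⊛ q
    pr = 0# ∷ p ⊛ r

  ⊛-distribʳ : ∀ p q r → (q ⊕ r) ⊛ p ≋ (q ⊛ p) ⊕ (r ⊛ p)
  ⊛-distribʳ p q r = ≋-trans (⊛-comm (q ⊕ r) p)
    (≋-trans (⊛-distribˡ p q r) (⊕-cong (⊛-comm p q) (⊛-comm p r)))

  ·-⊛ : ∀ a p q → (a · p) ⊛ q ≋ a · (p ⊛ q)
  ·-⊛ a []      q = ≋-refl
  ·-⊛ a (b ∷ p) q = ≋-trans
    (⊕-cong (·-assoc a b q) (∷-cong (sym (zeroʳ a)) (·-⊛ a p q)))
    (≋-sym (·-distrib-⊕ a (b · q) (0# ∷ p ⊛ q)))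

  0∷-⊛ : ∀ p q → (0# ∷ p) ⊛ q ≋ 0# ∷ p ⊛ q
  0∷-⊛ p q = ⊕-cong (0·≋[] q refl) ≋-refl

  ⊛-assoc : ∀ p q r → (p ⊛ q) ⊛ r ≋ p ⊛ (q ⊛ r)
  ⊛-assoc []      q r = ≋-refl
  ⊛-assoc (a ∷ p) q r = ≋-trans (⊛-distribʳ r (a · q) (0# ∷ p ⊛ q))
    (⊕-cong (·-⊛ a q r)
            (≋-trans (0∷-⊛ (p ⊛ q) r) (∷-cong refl (⊛-assoc p q r))))

  ⊛-identityˡ : ∀ p → 𝟙 ⊛ p ≋ p
  ⊛-identityˡ p = ≋-trans (⊕-cong (1·≋ p) 0∷[]) (⊕-identityʳ p)

  ⊛-identityʳ : ∀ p → p ⊛ 𝟙 ≋ p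
  ⊛-identityʳ p = ≋-trans (⊛-comm p 𝟙) (⊛-identityˡ p)

  polynomialRing : CommutativeRing c ℓ
  polynomialRing = record
    { Carrier = Poly
    ; _≈_ = _≋_
    ; _+_ = _⊕_
    ; _*_ = _⊛_
    ; -_  = ⊖_
    ; 0#  = 𝟘
    ; 1#  = 𝟙
    ; isCommutativeRing = record
      { isRing = record
        { +-isAbelianGroup = record
          { isGroup = record
            { isMonoid = record
              { isSemigroup = record
                { isMagma = record
                  { isEquivalence = Setoid.isEquivalence ≋-setoid
                  ; ∙-cong = ⊕-cong
                  }
                ; assoc = ⊕-assoc
                }
              ; identity = (λ p → ≋-refl) , ⊕-identityʳ
              }
            ; inverse = ⊖-inverseˡ , ⊖-inverseʳ
            ; ⁻¹-cong = ⊖-cong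
            }
          ; comm = ⊕-comm
          }
        ; *-cong = ⊛-cong
        ; *-assoc = ⊛-assoc
        ; *-identity = ⊛-identityˡ , ⊛-identityʳ
        ; distrib = ⊛-distribˡ , ⊛-distribʳ
        }
      ; *-comm = ⊛-comm
      }
    }

module PolynomialsOverDomain {c ℓ : Level} (D : IntegralDomain c ℓ) where
  open IntegralDomain D hiding (zero)
  open Polynomials commutativeRing

  ∷-≋? : ∀ {a b p q} → Dec (a ≈ b) → Dec (p ≋ q) → Dec (a ∷ p ≋ b ∷ q)
  ∷-≋? d e = map′ (λ (x , y) → ∷-cong x y)
                  (λ f → at f zero , mk≋ λ n → at f (suc n)) (d ×-dec e)

  _≋?_ : Decidable _≋_
  []      ≋? []      = yes (mk≋ λ _ → refl)
  (a ∷ p) ≋? (b ∷ q) = ∷-≋? (a ≈? b) (p ≋? q)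
  []      ≋? (b ∷ q) = map′ (λ e → mk≋ λ n → trans (sym (at 0∷[] n)) (at e n))
                            (λ e → mk≋ λ n → trans (at 0∷[] n) (at e n))
                            (∷-≋? (0# ≈? b) ([] ≋? q))
  (a ∷ p) ≋? []      = map′ (λ e → mk≋ λ n → trans (at e n) (at 0∷[] n))
                            (λ e → mk≋ λ n → trans (at e n) (sym (at 0∷[] n)))
                            (∷-≋? (a ≈? 0#) (p ≋? []))

  private
    module P = CommutativeRing polynomialRing
    open SetoidReasoning P.setoid

    ∷≋[] : ∀ {a p} → a ≈ 0# → p ≋ [] → a ∷ p ≋ []
    ∷≋[] e f = P.trans (∷-cong e f) 0∷[]

    tail≋[] : ∀ {a p} → a ∷ p ≋ [] → p ≋ []
    tail≋[] e = mk≋ λ n → at e (suc n)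

    dropˡ : ∀ a p q → a ≈ 0# → (a ∷ p) ⊛ q ≋ [] → p ⊛ q ≋ []
    dropˡ a p q a≈0 e = tail≋[] (begin
      0# ∷ (p ⊛ q)     ≈⟨ 0∷-⊛ p q ⟨
      (0# ∷ p) ⊛ q     ≈⟨ ⊛-congʳ {0# ∷ p} {a ∷ p} q (∷-cong (sym a≈0) P.refl) ⟩
      (a ∷ p) ⊛ q      ≈⟨ e ⟩
      []               ∎)

    dropʳ : ∀ p b q → b ≈ 0# → p ⊛ (b ∷ q) ≋ [] → p ⊛ q ≋ []
    dropʳ p b q b≈0 e = tail≋[] (begin
      0# ∷ (p ⊛ q)               ≈⟨ ⊕-cong (0·≋[] p b≈0) P.refl ⟨
      (b · p) ⊕ (0# ∷ (p ⊛ q))   ≈⟨ ⊛-∷ p b q ⟨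
      p ⊛ (b ∷ q)                ≈⟨ e ⟩
      []                         ∎)

  ⊛-noZeroDivisors : ∀ p q → p ⊛ q ≋ [] → p ≋ [] ⊎ q ≋ []
  ⊛-noZeroDivisors []      q       e = inj₁ P.refl
  ⊛-noZeroDivisors (a ∷ p) []      e = inj₂ P.refl
  ⊛-noZeroDivisors (a ∷ p) (b ∷ q) e = [
      (λ a≈0 → Sum.map₁ (∷≋[] a≈0)
        (⊛-noZeroDivisors p (b ∷ q) (dropˡ a p (b ∷ q) a≈0 e)))
    , (λ b≈0 → Sum.map₂ (∷≋[] b≈0)
        (⊛-noZeroDivisors (a ∷ p) q (dropʳ (a ∷ p) b q b≈0 e)))
    ]′ (noZeroDivisors (trans (sym (+-identityʳ _)) (at e zero)))

  polynomialDomain : IntegralDomain c ℓ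
  polynomialDomain = record
    { commutativeRing = polynomialRing
    ; _≈?_ = _≋?_
    ; 1≉0 = λ e → 1≉0 (at e zero)
    ; noZeroDivisors = λ {p} {q} → ⊛-noZeroDivisors p q
    }

module Fractions {c ℓ : Level} (D : IntegralDomain c ℓ) where
  open IntegralDomain D
  open RingProperties ring using (-‿distribˡ-*)
  open SemiringSolver commutativeSemiring using (solve; _:=_; _:+_; _:*_)
  open SetoidReasoning setoid

  record Fraction : Set (c ⊔ ℓ) where
    constructor mkFraction
    field
      num   : Carrier
      den   : Carrier
      den≉0 : ¬ (den ≈ 0#)
  open Fraction public

  infix 4 _≃_
  record _≃_ (x y : Fraction) : Set ℓ where
    constructor mk≃
    field
      cross : num x * den y ≈ num y * den x
  open _≃_ public

  *-nonZero : ∀ {x y} → ¬ (x ≈ 0#) → ¬ (y ≈ 0#) → ¬ (x * y ≈ 0#)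
  *-nonZero x≉0 y≉0 xy≈0 with noZeroDivisors xy≈0
  ... | inj₁ x≈0 = x≉0 x≈0
  ... | inj₂ y≈0 = y≉0 y≈0

  *-cancelʳ : ∀ {x y z} → ¬ (z ≈ 0#) → x * z ≈ y * z → x ≈ y
  *-cancelʳ {x} {y} {z} z≉0 xz≈yz with noZeroDivisors x-y*z≈0
    where
    x-y*z≈0 : (x - y) * z ≈ 0#
    x-y*z≈0 = begin
      (x - y) * z       ≈⟨ distribʳ z x (- y) ⟩
      x * z + - y * z   ≈⟨ +-cong xz≈yz (sym (-‿distribˡ-* y z)) ⟩
      y * z - y * z     ≈⟨ -‿inverseʳ (y * z) ⟩
      0#                ∎
  ... | inj₂ z≈0   = contradiction z≈0 z≉0
  ... | inj₁ x-y≈0 = begin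
      x               ≈⟨ +-identityʳ x ⟨
      x + 0#          ≈⟨ +-congˡ (-‿inverseˡ y) ⟨
      x + (- y + y)   ≈⟨ +-assoc x (- y) y ⟨
      (x - y) + y     ≈⟨ +-congʳ x-y≈0 ⟩
      0# + y          ≈⟨ +-identityˡ y ⟩
      y               ∎

  ≃-trans : ∀ {x y z} → x ≃ y → y ≃ z → x ≃ z
  ≃-trans {mkFraction a b _} {mkFraction a′ b′ b′≉0} {mkFraction a″ b″ _} (mk≃ e) (mk≃ f) =
    mk≃ (*-cancelʳ b′≉0 (begin
      a * b″ * b′   ≈⟨ solve 3 (λ x y z → x :* y :* z := x :* z :* y) refl a b″ b′ ⟩
      a * b′ * b″   ≈⟨ *-congʳ e ⟩
      a′ * b * b″   ≈⟨ solve 3 (λ x y z → x :* y :* z := x :* z :* y) refl a′ b b″ ⟩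
      a′ * b″ * b   ≈⟨ *-congʳ f ⟩
      a″ * b′ * b   ≈⟨ solve 3 (λ x y z → x :* y :* z := x :* z :* y) refl a″ b′ b ⟩
      a″ * b * b′   ∎))

  ≃-setoid : Setoid (c ⊔ ℓ) ℓ
  ≃-setoid = record
    { Carrier = Fraction
    ; _≈_ = _≃_
    ; isEquivalence = record
      { refl  = mk≃ refl
      ; sym   = λ e → mk≃ (sym (cross e))
      ; trans = ≃-trans
      }
    }

  infixl 6 _+ᶠ_
  _+ᶠ_ : Fraction → Fraction → Fraction
  x +ᶠ y = record
    { num   = num x * den y + num y * den x
    ; den   = den x * den y
    ; den≉0 = *-nonZero (den≉0 x) (den≉0 y)
    }

  infixl 7 _*ᶠ_
  _*ᶠ_ : Fraction → Fraction → Fraction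
  x *ᶠ y = record
    { num   = num x * num y
    ; den   = den x * den y
    ; den≉0 = *-nonZero (den≉0 x) (den≉0 y)
    }

  -ᶠ_ : Fraction → Fraction
  -ᶠ x = record { num = - num x ; den = den x ; den≉0 = den≉0 x }

  embed : Carrier → Fraction
  embed x = record { num = x ; den = 1# ; den≉0 = 1≉0 }

  0ᶠ 1ᶠ : Fraction
  0ᶠ = embed 0#
  1ᶠ = embed 1#

  num≈0⇒≃0 : ∀ {x} → num x ≈ 0# → x ≃ 0ᶠ
  num≈0⇒≃0 {x} e = mk≃ (trans (*-identityʳ _) (trans e (sym (zeroˡ (den x)))))

  ≃0⇒num≈0 : ∀ {x} → x ≃ 0ᶠ → num x ≈ 0#
  ≃0⇒num≈0 {x} e = trans (sym (*-identityʳ _)) (trans (cross e) (zeroˡ (den x)))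

  inverse : (x : Fraction) → Dec (num x ≈ 0#) → Fraction
  inverse x (yes _)    = 0ᶠ
  inverse x (no num≉0) = record { num = den x ; den = num x ; den≉0 = num≉0 }

  infix 8 _⁻¹ᶠ
  _⁻¹ᶠ : Fraction → Fraction
  x ⁻¹ᶠ = inverse x (num x ≈? 0#)

  +ᶠ-cong : ∀ {x x′ y y′} → x ≃ x′ → y ≃ y′ → x +ᶠ y ≃ x′ +ᶠ y′
  +ᶠ-cong {mkFraction a b _} {mkFraction a′ b′ _} {mkFraction u v _} {mkFraction u′ v′ _}
    (mk≃ e) (mk≃ f) = mk≃ (begin
    (a * v + u * b) * (b′ * v′)
      ≈⟨ solve 6 (λ a b u v b′ v′ → (a :* v :+ u :* b) :* (b′ :* v′)
                   := (a :* b′) :* (v :* v′) :+ (u :* v′) :* (b :* b′)) refl a b u v b′ v′ ⟩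
    (a * b′) * (v * v′) + (u * v′) * (b * b′)
      ≈⟨ +-cong (*-congʳ e) (*-congʳ f) ⟩
    (a′ * b) * (v * v′) + (u′ * v) * (b * b′)
      ≈⟨ solve 6 (λ a′ b u′ v b′ v′ → (a′ :* b) :* (v :* v′) :+ (u′ :* v) :* (b :* b′)
                   := (a′ :* v′ :+ u′ :* b′) :* (b :* v)) refl a′ b u′ v b′ v′ ⟩
    (a′ * v′ + u′ * b′) * (b * v) ∎)

  *ᶠ-cong : ∀ {x x′ y y′} → x ≃ x′ → y ≃ y′ → x *ᶠ y ≃ x′ *ᶠ y′
  *ᶠ-cong {mkFraction a b _} {mkFraction a′ b′ _} {mkFraction u v _} {mkFraction u′ v′ _}
    (mk≃ e) (mk≃ f) = mk≃ (begin
    (a * u) * (b′ * v′)   ≈⟨ swap a u b′ v′ ⟩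
    (a * b′) * (u * v′)   ≈⟨ *-cong e f ⟩
    (a′ * b) * (u′ * v)   ≈⟨ swap a′ b u′ v ⟩
    (a′ * u′) * (b * v)   ∎)
    where
    swap : ∀ p q r s → (p * q) * (r * s) ≈ (p * r) * (q * s)
    swap = solve 4 (λ p q r s → (p :* q) :* (r :* s) := (p :* r) :* (q :* s)) refl

  -ᶠ-cong : ∀ {x y} → x ≃ y → -ᶠ x ≃ -ᶠ y
  -ᶠ-cong {x} {y} (mk≃ e) = mk≃ (begin
    - num x * den y     ≈⟨ -‿distribˡ-* (num x) (den y) ⟨
    - (num x * den y)   ≈⟨ -‿cong e ⟩
    - (num y * den x)   ≈⟨ -‿distribˡ-* (num y) (den x) ⟩
    - num y * den x     ∎)

  +ᶠ-comm : ∀ x y → x +ᶠ y ≃ y +ᶠ x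
  +ᶠ-comm x y = mk≃ (*-cong (+-comm _ _) (*-comm _ _))

  +ᶠ-assoc : ∀ x y z → (x +ᶠ y) +ᶠ z ≃ x +ᶠ (y +ᶠ z)
  +ᶠ-assoc (mkFraction a b _) (mkFraction u v _) (mkFraction p q _) = mk≃
    (solve 6 (λ a b u v p q →
      ((a :* v :+ u :* b) :* q :+ p :* (b :* v)) :* (b :* (v :* q))
      := (a :* (v :* q) :+ (u :* q :+ p :* v) :* b) :* ((b :* v) :* q)) refl a b u v p q)

  +ᶠ-identityˡ : ∀ x → 0ᶠ +ᶠ x ≃ x
  +ᶠ-identityˡ x = mk≃ (*-cong
    (trans (+-cong (zeroˡ _) (*-identityʳ _)) (+-identityˡ _)) (sym (*-identityˡ _)))

  -ᶠ-inverseˡ : ∀ x → (-ᶠ x) +ᶠ x ≃ 0ᶠ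
  -ᶠ-inverseˡ x = num≈0⇒≃0 (begin
    - num x * den x + num x * den x   ≈⟨ distribʳ (den x) (- num x) (num x) ⟨
    (- num x + num x) * den x         ≈⟨ *-congʳ (-‿inverseˡ (num x)) ⟩
    0# * den x                        ≈⟨ zeroˡ (den x) ⟩
    0#                                ∎)

  *ᶠ-comm : ∀ x y → x *ᶠ y ≃ y *ᶠ x
  *ᶠ-comm x y = mk≃ (*-cong (*-comm _ _) (*-comm _ _))

  *ᶠ-assoc : ∀ x y z → (x *ᶠ y) *ᶠ z ≃ x *ᶠ (y *ᶠ z)
  *ᶠ-assoc x y z = mk≃ (*-cong (*-assoc _ _ _) (sym (*-assoc _ _ _)))

  *ᶠ-identityˡ : ∀ x → 1ᶠ *ᶠ x ≃ x
  *ᶠ-identityˡ x = mk≃ (*-cong (*-identityˡ _) (sym (*-identityˡ _)))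

  *ᶠ-distribˡ : ∀ x y z → x *ᶠ (y +ᶠ z) ≃ (x *ᶠ y) +ᶠ (x *ᶠ z)
  *ᶠ-distribˡ (mkFraction a b _) (mkFraction u v _) (mkFraction p q _) = mk≃
    (solve 6 (λ a b u v p q →
      (a :* (u :* q :+ p :* v)) :* ((b :* v) :* (b :* q))
      := ((a :* u) :* (b :* q) :+ (a :* p) :* (b :* v)) :* (b :* (v :* q)))
      refl a b u v p q)

  private
    module F = Setoid ≃-setoid

  fractionRing : CommutativeRing (c ⊔ ℓ) ℓ
  fractionRing = record
    { Carrier = Fraction
    ; _≈_ = _≃_
    ; _+_ = _+ᶠ_
    ; _*_ = _*ᶠ_
    ; -_  = -ᶠ_
    ; 0#  = 0ᶠ
    ; 1#  = 1ᶠ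
    ; isCommutativeRing = record
      { isRing = record
        { +-isAbelianGroup = record
          { isGroup = record
            { isMonoid = record
              { isSemigroup = record
                { isMagma = record
                  { isEquivalence = F.isEquivalence
                  ; ∙-cong = +ᶠ-cong
                  }
                ; assoc = +ᶠ-assoc
                }
              ; identity = +ᶠ-identityˡ
                         , λ x → F.trans (+ᶠ-comm x 0ᶠ) (+ᶠ-identityˡ x)
              }
            ; inverse = -ᶠ-inverseˡ
                      , λ x → F.trans (+ᶠ-comm x (-ᶠ x)) (-ᶠ-inverseˡ x)
            ; ⁻¹-cong = -ᶠ-cong
            }
          ; comm = +ᶠ-comm
          }
        ; *-cong = *ᶠ-cong
        ; *-assoc = *ᶠ-assoc
        ; *-identity = *ᶠ-identityˡ
                     , λ x → F.trans (*ᶠ-comm x 1ᶠ) (*ᶠ-identityˡ x)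
        ; distrib = *ᶠ-distribˡ
                  , λ x y z → F.trans (*ᶠ-comm (y +ᶠ z) x) (F.trans (*ᶠ-distribˡ x y z)
                      (+ᶠ-cong (*ᶠ-comm x y) (*ᶠ-comm x z)))
        }
      ; *-comm = *ᶠ-comm
      }
    }

  inverse-cong : ∀ {x y} → x ≃ y → (d : Dec (num x ≈ 0#)) (e : Dec (num y ≈ 0#)) →
                 inverse x d ≃ inverse y e
  inverse-cong x≃y (yes _)   (yes _)   = F.refl
  inverse-cong x≃y (yes x≈0) (no y≉0)  =
    contradiction (≃0⇒num≈0 (F.trans (F.sym x≃y) (num≈0⇒≃0 x≈0))) y≉0
  inverse-cong x≃y (no x≉0)  (yes y≈0) =
    contradiction (≃0⇒num≈0 (F.trans x≃y (num≈0⇒≃0 y≈0))) x≉0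
  inverse-cong {x} {y} x≃y (no _) (no _) = mk≃ (begin
    den x * num y   ≈⟨ *-comm _ _ ⟩
    num y * den x   ≈⟨ cross x≃y ⟨
    num x * den y   ≈⟨ *-comm _ _ ⟩
    den y * num x   ∎)

  inverse-inverseʳ : ∀ {x} → ¬ (x ≃ 0ᶠ) → (d : Dec (num x ≈ 0#)) → x *ᶠ inverse x d ≃ 1ᶠ
  inverse-inverseʳ     x≄0 (yes x≈0) = contradiction (num≈0⇒≃0 x≈0) x≄0
  inverse-inverseʳ {x} x≄0 (no _)    = mk≃ (begin
    num x * den x * 1#     ≈⟨ *-identityʳ _ ⟩
    num x * den x          ≈⟨ *-comm _ _ ⟩
    den x * num x          ≈⟨ *-identityˡ _ ⟨
    1# * (den x * num x)   ∎)

  inverse-0 : (d : Dec (0# ≈ 0#)) → inverse 0ᶠ d ≃ 0ᶠ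
  inverse-0 (yes _)  = F.refl
  inverse-0 (no 0≉0) = contradiction refl 0≉0

  fractionField : Field (c ⊔ ℓ) ℓ
  fractionField = record
    { commutativeRing = fractionRing
    ; _≈?_ = λ x y → map′ mk≃ cross ((num x * den y) ≈? (num y * den x))
    ; 1≉0 = λ e → 1≉0 (≃0⇒num≈0 e)
    ; _⁻¹ = _⁻¹ᶠ
    ; ⁻¹-cong = λ {x} {y} e → inverse-cong e (num x ≈? 0#) (num y ≈? 0#)
    ; *-inverseʳ = λ {x} x≄0 → inverse-inverseʳ x≄0 (num x ≈? 0#)
    ; 0⁻¹≈0 = inverse-0 (0# ≈? 0#)
    }

ℚ-domain : IntegralDomain 0ℓ 0ℓ
ℚ-domain = record
  { commutativeRing = ℚ.+-*-commutativeRing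
  ; _≈?_ = ℚ._≟_
  ; 1≉0 = λ ()
  ; noZeroDivisors = λ {p} {q} → noZeroDivisors p q
  }
  where
  open import Data.Rational.Base using (_*_; 0ℚ; 1ℚ; 1/_)
  open ≡ using (_≡_)
  open ≡.≡-Reasoning
  noZeroDivisors : ∀ p q → p * q ≡ 0ℚ → p ≡ 0ℚ ⊎ q ≡ 0ℚ
  noZeroDivisors p q pq≡0 with p ℚ.≟ 0ℚ
  ... | yes p≡0 = inj₁ p≡0
  ... | no  p≢0 = inj₂ (begin
    q                ≡⟨ ℚ.*-identityˡ q ⟨
    1ℚ * q           ≡⟨ ≡.cong (_* q) (ℚ.*-inverseˡ p) ⟨
    1/ p * p * q     ≡⟨ ℚ.*-assoc (1/ p) p q ⟩
    1/ p * (p * q)   ≡⟨ ≡.cong (1/ p *_) pq≡0 ⟩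
    1/ p * 0ℚ        ≡⟨ ℚ.*-zeroʳ (1/ p) ⟩
    0ℚ               ∎)
    where instance _ = ℚ.≢-nonZero p≢0

ℚ[s] : IntegralDomain 0ℓ 0ℓ
ℚ[s] = PolynomialsOverDomain.polynomialDomain ℚ-domain

ℚ[s][t] : IntegralDomain 0ℓ 0ℓ
ℚ[s][t] = PolynomialsOverDomain.polynomialDomain ℚ[s]

ℚ⟨s,t⟩ : Field 0ℓ 0ℓ
ℚ⟨s,t⟩ = Fractions.fractionField ℚ[s][t]

-- s is the variable of ℚ[s], as a constant polynomial in t; t is the variable
-- of ℚ[s][t].
s t : Field.Carrier ℚ⟨s,t⟩
s = Fractions.embed ℚ[s][t] (ℚ[s]-Poly.const ℚ-Poly.X)
  where
  module ℚ-Poly    = Polynomials ℚ.+-*-commutativeRing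
  module ℚ[s]-Poly = Polynomials (IntegralDomain.commutativeRing ℚ[s])
t = Fractions.embed ℚ[s][t] (Polynomials.X (IntegralDomain.commutativeRing ℚ[s]))

module OverField {c ℓ : Level} (K : Field c ℓ) where
  open Field K hiding (zero)
  open RawMonoidOps +-rawMonoid using (_×_; sum)
  open RawMonoidOps *-rawMonoid using () renaming (sum to product)
  open RawSemiringOps (Semiring.rawSemiring semiring) using (_^_) public

  fromℕ : ℕ → Carrier
  fromℕ n = n × 1#

  ½ : Carrier
  ½ = 1# / fromℕ 2

  -- ∏[ i < n ] ranges over 0 ≤ i ≤ n-1.
  infixl 10 ∏-syntax
  ∏-syntax : (n : ℕ) → (ℕ → Carrier) → Carrier
  ∏-syntax n f = product (λ (i : Fin n) → f (toℕ i))
  syntax ∏-syntax n (λ i → x) = ∏[ i < n ] x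

  infixl 10 ∏₁-syntax
  ∏₁-syntax : (n : ℕ) → (ℕ → Carrier) → Carrier
  ∏₁-syntax n f = ∏[ i < n ] f (suc i)
  syntax ∏₁-syntax n (λ i → x) = ∏[1≤ i ≤ n ] x

  pochhammer : Carrier → ℕ → Carrier
  pochhammer γ m = ∏[ i < m ] (γ + fromℕ i)

  -- The determinant, by Laplace expansion along the first row.
  det : ∀ {n} → (Fin n → Fin n → Carrier) → Carrier
  det {zero}  A = 1#
  det {suc n} A = sum λ j →
    (- 1#) ^ toℕ j * A zero j * det (λ i k → A (suc i) (punchIn j k))

  -- Formal power series, given by the coefficient of each xⁿ.
  PowerSeries : Set c
  PowerSeries = ℕ → Carrier

  infixl 6 _+ˢ_
  _+ˢ_ : PowerSeries → PowerSeries → PowerSeries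
  (f +ˢ g) n = f n + g n

  -- evenSeries u = Σ_{k ≥ 0} u k x²ᵏ
  evenSeries : (ℕ → Carrier) → PowerSeries
  evenSeries u zero          = u zero
  evenSeries u (suc zero)    = 0#
  evenSeries u (suc (suc n)) = evenSeries (λ k → u (suc k)) n

  ∫₀ˣ : PowerSeries → PowerSeries
  ∫₀ˣ f zero    = 0#
  ∫₀ˣ f (suc n) = f n / fromℕ (suc n)

  cosb : Carrier → PowerSeries
  cosb γ = evenSeries λ k →
    (- 1#) ^ k / (fromℕ 4 ^ k * fromℕ (k !) * pochhammer (γ + 1#) k)

  f : Carrier → Carrier → PowerSeries
  f σ τ = cosb σ +ˢ ∫₀ˣ (cosb τ)

  -- f σ τ = Σ_{k ≥ 0} a σ τ k xᵏ/k!
  a : Carrier → Carrier → ℕ → Carrier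
  a σ τ k = fromℕ (k !) * f σ τ k

{-# OPTIONS --safe #-}
-- Let μ be the functional with μ(yⁱ) = a₂ᵢ, or with μ(yⁱ) = a₂ᵢ₊₁; up to y ↦ -y it is integration
-- against a Beta density, so μ(yⁱ(1+y)ᵖ) = (-1)ⁱ (½)ᵢ (σ+½)ₚ / (σ+1)ᵢ₊ₚ with σ = s, resp. t. Replacing
-- the columns yᵖ of the two interleaved Hankel blocks by (1+y)ᵖ is unitriangular. After extracting
-- (-1)ⁱ (½)ᵢ from row i and (σ+½)ₚ / (σ+1)ₙ₋₁₊ₚ from the column of (σ , p), the entry that remains is
-- (x+i+1)⋯(x+n-1) at x = σ+p, a monic polynomial in x of degree n-1-i. What is left is therefore a
-- Vandermonde determinant in the points s, t, s+1, t+1, …: its differences within a block give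
-- factorials, and those across the blocks give the double product.
module Submission where

open import Defs
open import Data.Fin.Base using (Fin; toℕ)
open import Data.Nat.Base as ℕ using (ℕ; _∸_; _≥_; _!; ⌈_/2⌉; ⌊_/2⌋)
open import Data.Nat.Combinatorics using (_C_)
import Algebra.Definitions.RawMonoid as RawMonoidOps
open import Algebra.Bundles using (CommutativeRing; RawRing)
import Algebra.Properties.CommutativeMonoid.Sum as CommutativeMonoidSums
import Algebra.Properties.CommutativeSemiring.Exp as CommutativeSemiringExp
import Algebra.Properties.Ring as RingProperties
import Algebra.Properties.Semiring.Exp as SemiringExp
import Algebra.Properties.Semiring.Mult as SemiringMult
import Algebra.Properties.Semiring.Mult.TCOptimised as OptimisedMult
import Algebra.Properties.Semiring.Sum as SemiringSums
import Algebra.Solver.Ring as RingSolver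
open import Algebra.Solver.Ring.AlmostCommutativeRing
  using (fromCommutativeRing; _-Raw-AlmostCommutative⟶_)
open import Data.Fin.Base using (zero; suc; punchIn; fromℕ<; opposite)
import Data.Fin.Properties as Fin
open import Data.Integer.Base as ℤ using (ℤ; +_; -[1+_])
import Data.Integer.Properties as ℤ
import Data.Maybe.Base as Maybe
open import Data.Nat.Base using (zero; suc)
open import Data.Nat.Combinatorics using (nCk+nC[k+1]≡[n+1]C[k+1]; nC1≡n)
import Data.Nat.Properties as ℕ
open import Data.Nat.Tactic.RingSolver using (solve-∀)
open import Data.Product.Base using (_,_; _×_; ∃)
open import Data.Rational.Base as ℚ using (ℚ; 0ℚ; 1ℚ)
import Data.Rational.Properties as ℚ
open import Data.Sum.Base as Sum using (_⊎_; inj₁; inj₂)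
import Data.Sign.Base as Sign
open import Data.Vec.Functional using (updateAt)
open import Data.Vec.Functional.Properties using (updateAt-updates; updateAt-minimal)
open import Function.Base using (const; _∘_; id)
open import Level using (0ℓ; _⊔_)
open import Relation.Binary.PropositionalEquality as ≡ using (_≡_; _≢_)
import Relation.Binary.Reasoning.Setoid as SetoidReasoning
open import Relation.Nullary.Decidable using (yes; no; dec⇒maybe)
open import Relation.Nullary.Negation using (¬_; contradiction)

-- No integral is formed. Multiplication by y is a shift of rows, so the values μ(yⁱ(1+y)ᵖ) are
-- built by adding neighbouring rows, and the Beta formula becomes an induction on p that rests on
-- (σ+1+i+p) - (½+i) = σ+½+p. The computation works over any field of characteristic 0, at
-- parameters σ for which no (σ+1)ₘ vanishes; ℚ(s,t) enters only at the end. The differences within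
-- the two blocks give only the factorials i! with i < ⌈n/2⌉ and i < ⌊n/2⌋, whereas (2i)! = 4ⁱ i!
-- (½)ᵢ calls for every i! with i < n. The missing ratio is the product of the hook lengths of a
-- ⌈n/2⌉ by ⌊n/2⌋ rectangle. This is the origin of the denominators n-r-c+1, while the powers 4ⁱ
-- account for 2 to the n(n-1). The global sign is what remains of the row signs (-1)ⁱ and of the
-- orientation of the differences.

-- Ring normalisation with integer coefficients.

module IntegerCoefficients {c ℓ} (R : CommutativeRing c ℓ) where
  open CommutativeRing R
  open RingProperties ring
  open OptimisedMult semiring using (1+×; ×-homo-+; ×1-homo-*) renaming (_×_ to _•_)
  open SetoidReasoning setoid

  ℤ-rawRing : RawRing 0ℓ 0ℓ
  ℤ-rawRing = record
    { Carrier = ℤ ; _≈_ = _≡_ ; _+_ = ℤ._+_ ; _*_ = ℤ._*_ ; -_ = ℤ.-_ ; 0# = + 0 ; 1# = + 1 }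

  -- The optimised multiple makes `⟦ + 1 ⟧ᶻ` reduce to `1#` itself, so `con (+ 1)` matches the
  -- literal `1#` in a goal.
  ⟦_⟧ᶻ : ℤ → Carrier
  ⟦ + n ⟧ᶻ      = n • 1#
  ⟦ -[1+ n ] ⟧ᶻ = - (suc n • 1#)

  [x+y]-[x+z]≈y-z : ∀ x y z → (x + y) - (x + z) ≈ y - z
  [x+y]-[x+z]≈y-z x y z = begin
    (x + y) - (x + z)     ≈⟨ +-congʳ (+-comm x y) ⟩
    (y + x) - (x + z)     ≈⟨ +-congˡ (-‿+-comm x z) ⟨
    (y + x) + (- x - z)   ≈⟨ +-assoc y x _ ⟩
    y + (x + (- x - z))   ≈⟨ +-congˡ (+-assoc x (- x) (- z)) ⟨
    y + ((x - x) - z)     ≈⟨ +-congˡ (+-congʳ (-‿inverseʳ x)) ⟩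
    y + (0# - z)          ≈⟨ +-congˡ (+-identityˡ (- z)) ⟩
    y - z                 ∎

  ⊖-homo : ∀ m n → ⟦ m ℤ.⊖ n ⟧ᶻ ≈ m • 1# - n • 1#
  ⊖-homo m zero          = sym (trans (+-congˡ -0#≈0#) (+-identityʳ _))
  ⊖-homo zero (suc n)    = sym (+-identityˡ _)
  ⊖-homo (suc m) (suc n) = begin
    ⟦ suc m ℤ.⊖ suc n ⟧ᶻ              ≡⟨ ≡.cong ⟦_⟧ᶻ (ℤ.[1+m]⊖[1+n]≡m⊖n m n) ⟩
    ⟦ m ℤ.⊖ n ⟧ᶻ                      ≈⟨ ⊖-homo m n ⟩
    m • 1# - n • 1#                   ≈⟨ [x+y]-[x+z]≈y-z 1# _ _ ⟨
    (1# + m • 1#) - (1# + n • 1#)     ≈⟨ +-cong (1+× m 1#) (-‿cong (1+× n 1#)) ⟨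
    suc m • 1# - suc n • 1#           ∎

  +-homo : ∀ i j → ⟦ i ℤ.+ j ⟧ᶻ ≈ ⟦ i ⟧ᶻ + ⟦ j ⟧ᶻ
  +-homo (+ m)      (+ n)      = ×-homo-+ 1# m n
  +-homo (+ m)      -[1+ n ]   = ⊖-homo m (suc n)
  +-homo -[1+ m ]   (+ n)      = trans (⊖-homo n (suc m)) (+-comm _ _)
  +-homo -[1+ m ]   -[1+ n ]   = begin
    - (suc (suc (m ℕ.+ n)) • 1#)          ≈⟨ -‿cong (1+× (suc m ℕ.+ n) 1#) ⟩
    - (1# + (suc m ℕ.+ n) • 1#)           ≈⟨ -‿cong (+-congˡ (×-homo-+ 1# (suc m) n)) ⟩
    - (1# + (suc m • 1# + n • 1#))        ≈⟨ -‿cong (+-assoc _ _ _) ⟨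
    - ((1# + suc m • 1#) + n • 1#)        ≈⟨ -‿cong (+-congʳ (+-comm _ _)) ⟩
    - ((suc m • 1# + 1#) + n • 1#)        ≈⟨ -‿cong (+-assoc _ _ _) ⟩
    - (suc m • 1# + (1# + n • 1#))        ≈⟨ -‿cong (+-congˡ (1+× n 1#)) ⟨
    - (suc m • 1# + suc n • 1#)           ≈⟨ -‿+-comm _ _ ⟨
    - (suc m • 1#) - (suc n • 1#)         ∎

  -homo : ∀ i → ⟦ ℤ.- i ⟧ᶻ ≈ - ⟦ i ⟧ᶻ
  -homo (+ zero)  = sym -0#≈0#
  -homo (+ suc n) = refl
  -homo -[1+ n ]  = sym (-‿involutive _)

  *-homo : ∀ i j → ⟦ i ℤ.* j ⟧ᶻ ≈ ⟦ i ⟧ᶻ * ⟦ j ⟧ᶻ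
  *-homo (+ m) (+ n) = begin
    ⟦ Sign.+ ℤ.◃ m ℕ.* n ⟧ᶻ   ≡⟨ ≡.cong ⟦_⟧ᶻ (ℤ.+◃n≡+n (m ℕ.* n)) ⟩
    (m ℕ.* n) • 1#            ≈⟨ ×1-homo-* m n ⟩
    m • 1# * (n • 1#)         ∎
  *-homo (+ m) -[1+ n ] = begin
    ⟦ Sign.- ℤ.◃ m ℕ.* suc n ⟧ᶻ   ≡⟨ ≡.cong ⟦_⟧ᶻ (ℤ.-◃n≡-n (m ℕ.* suc n)) ⟩
    ⟦ ℤ.- + (m ℕ.* suc n) ⟧ᶻ      ≈⟨ -homo (+ (m ℕ.* suc n)) ⟩
    - ((m ℕ.* suc n) • 1#)        ≈⟨ -‿cong (×1-homo-* m (suc n)) ⟩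
    - (m • 1# * (suc n • 1#))     ≈⟨ -‿distribʳ-* _ _ ⟩
    m • 1# * - (suc n • 1#)       ∎
  *-homo -[1+ m ] (+ n) = begin
    ⟦ Sign.- ℤ.◃ suc m ℕ.* n ⟧ᶻ   ≡⟨ ≡.cong ⟦_⟧ᶻ (ℤ.-◃n≡-n (suc m ℕ.* n)) ⟩
    ⟦ ℤ.- + (suc m ℕ.* n) ⟧ᶻ      ≈⟨ -homo (+ (suc m ℕ.* n)) ⟩
    - ((suc m ℕ.* n) • 1#)        ≈⟨ -‿cong (×1-homo-* (suc m) n) ⟩
    - (suc m • 1# * (n • 1#))     ≈⟨ -‿distribˡ-* _ _ ⟩
    - (suc m • 1#) * (n • 1#)     ∎
  *-homo -[1+ m ] -[1+ n ] = begin
    (suc m ℕ.* suc n) • 1#            ≈⟨ ×1-homo-* (suc m) (suc n) ⟩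
    suc m • 1# * (suc n • 1#)         ≈⟨ -‿involutive _ ⟨
    - - (suc m • 1# * (suc n • 1#))   ≈⟨ -‿cong (-‿distribˡ-* _ _) ⟩
    - (- (suc m • 1#) * (suc n • 1#)) ≈⟨ -‿distribʳ-* _ _ ⟩
    - (suc m • 1#) * - (suc n • 1#)   ∎

  homomorphism : ℤ-rawRing -Raw-AlmostCommutative⟶ fromCommutativeRing R
  homomorphism = record
    { ⟦_⟧ = ⟦_⟧ᶻ ; +-homo = +-homo ; *-homo = *-homo ; -‿homo = -homo ; 0-homo = refl ; 1-homo = refl }

  ≡⇒⟦⟧ᶻ≈ : ∀ {i j} → i ≡ j → ⟦ i ⟧ᶻ ≈ ⟦ j ⟧ᶻ
  ≡⇒⟦⟧ᶻ≈ e = reflexive (≡.cong ⟦_⟧ᶻ e)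

  open RingSolver ℤ-rawRing (fromCommutativeRing R) homomorphism
    (λ i j → Maybe.map ≡⇒⟦⟧ᶻ≈ (dec⇒maybe (i ℤ.≟ j))) public

-- Cancellation and division in a field.

module FieldProperties {c ℓ} (K : Field c ℓ) where
  open Field K hiding (zero)
  open SetoidReasoning setoid

  *-nonZero : ∀ {x y} → ¬ (x ≈ 0#) → ¬ (y ≈ 0#) → ¬ (x * y ≈ 0#)
  *-nonZero {x} {y} x≉0 y≉0 xy≈0 = y≉0 (begin
    y                ≈⟨ *-identityˡ y ⟨
    1# * y           ≈⟨ *-congʳ (*-inverseʳ x≉0) ⟨
    x * x ⁻¹ * y     ≈⟨ *-congʳ (*-comm x (x ⁻¹)) ⟩
    x ⁻¹ * x * y     ≈⟨ *-assoc _ _ _ ⟩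
    x ⁻¹ * (x * y)   ≈⟨ *-congˡ xy≈0 ⟩
    x ⁻¹ * 0#        ≈⟨ zeroʳ _ ⟩
    0#               ∎)

  *-cancelˡ : ∀ {z x y} → ¬ (z ≈ 0#) → z * x ≈ z * y → x ≈ y
  *-cancelˡ {z} {x} {y} z≉0 zx≈zy = begin
    x                ≈⟨ cancel x ⟨
    z ⁻¹ * (z * x)   ≈⟨ *-congˡ zx≈zy ⟩
    z ⁻¹ * (z * y)   ≈⟨ cancel y ⟩
    y                ∎
    where
    cancel : ∀ w → z ⁻¹ * (z * w) ≈ w
    cancel w = begin
      z ⁻¹ * (z * w)   ≈⟨ *-assoc _ _ _ ⟨
      z ⁻¹ * z * w     ≈⟨ *-congʳ (trans (*-comm _ _) (*-inverseʳ z≉0)) ⟩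
      1# * w           ≈⟨ *-identityˡ w ⟩
      w                ∎

  *≈⇒≈/ : ∀ {x y z} → ¬ (z ≈ 0#) → x * z ≈ y → x ≈ y / z
  *≈⇒≈/ {x} {y} {z} z≉0 e = begin
    x                ≈⟨ *-identityʳ x ⟨
    x * 1#           ≈⟨ *-congˡ (*-inverseʳ z≉0) ⟨
    x * (z * z ⁻¹)   ≈⟨ *-assoc _ _ _ ⟨
    x * z * z ⁻¹     ≈⟨ *-congʳ e ⟩
    y / z            ∎

  /-* : ∀ {x z} → ¬ (z ≈ 0#) → x / z * z ≈ x
  /-* {x} {z} z≉0 = begin
    x * z ⁻¹ * z     ≈⟨ *-assoc _ _ _ ⟩
    x * (z ⁻¹ * z)   ≈⟨ *-congˡ (trans (*-comm _ _) (*-inverseʳ z≉0)) ⟩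
    x * 1#           ≈⟨ *-identityʳ x ⟩
    x                ∎

-- Determinants from the first-row expansion: transposition, linearity, exchange of columns.

module Determinants {c ℓ} (K : Field c ℓ) where
  open Field K hiding (zero)
  open OverField K
  open IntegerCoefficients commutativeRing using (solve; _:=_; _:+_; _:*_; _:-_; :-_; con)
  open SetoidReasoning setoid
  open SemiringSums semiring using (sum; sum-cong-≋; ∑-comm; ∑-distrib-+; *-distribˡ-sum)
  open CommutativeMonoidSums *-commutativeMonoid using () renaming (sum to product)

  Matrix : ℕ → Set c
  Matrix n = Fin n → Fin n → Carrier

  infix 4 _≐_
  _≐_ : ∀ {x} {X : Set x} → (X → Carrier) → (X → Carrier) → Set (x ⊔ ℓ)
  v ≐ w = ∀ x → v x ≈ w x

  _ᵀ : ∀ {n} → Matrix n → Matrix n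
  (A ᵀ) i j = A j i

  minor : ∀ {n} → Matrix (suc n) → Fin (suc n) → Matrix n
  minor A j i k = A (suc i) (punchIn j k)

  laplace : ∀ {n} → Matrix (suc n) → Fin (suc n) → Carrier
  laplace A j = (- 1#) ^ toℕ j * A zero j * det (minor A j)

  det-cong : ∀ {n} {A B : Matrix n} → (∀ i → A i ≐ B i) → det A ≈ det B
  det-cong {zero}  e = refl
  det-cong {suc n} {A} {B} e = sum-cong-≋ {x = laplace A} {laplace B} λ j →
    *-cong (*-congˡ {(- 1#) ^ toℕ j} (e zero j)) (det-cong λ i k → e (suc i) (punchIn j k))

  -- Expanding along the first row and each remaining minor along its first
  -- column gives an expression that is symmetric under transposition.
  det-ᵀ : ∀ {n} (A : Matrix n) → det A ≈ det (A ᵀ)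
  det-ᵀ {zero}        A = refl
  det-ᵀ {suc zero}    A = refl
  det-ᵀ {suc (suc m)} A = begin
    det A
      ≈⟨ expand det-ᵀ A ⟩
    corner A + sum (λ j → sum λ i → term A i j)
      ≈⟨ +-cong (*-congˡ (det-ᵀ (minor A zero))) (∑-comm λ j i → term A i j) ⟩
    corner (A ᵀ) + sum (λ i → sum λ j → term A i j)
      ≈⟨ +-congˡ (sum-cong-≋ λ i → sum-cong-≋ λ j → term-ᵀ i j) ⟩
    corner (A ᵀ) + sum (λ i → sum λ j → term (A ᵀ) j i)
      ≈⟨ expand det-ᵀ (A ᵀ) ⟨
    det (A ᵀ) ∎
    where
    core : Matrix (suc (suc m)) → Fin (suc m) → Fin (suc m) → Matrix m
    core A i j a b = A (suc (punchIn i a)) (suc (punchIn j b))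

    corner : Matrix (suc (suc m)) → Carrier
    corner A = 1# * A zero zero * det (minor A zero)

    inner : Matrix (suc (suc m)) → Fin (suc m) → Fin (suc m) → Carrier
    inner A j i = (- 1#) ^ toℕ i * A (suc i) zero * det (core A i j)

    term : Matrix (suc (suc m)) → Fin (suc m) → Fin (suc m) → Carrier
    term A i j = (- 1#) ^ suc (toℕ j) * A zero (suc j) * inner A j i

    expand : (∀ (B : Matrix (suc m)) → det B ≈ det (B ᵀ)) →
             ∀ A → det A ≈ corner A + sum (λ j → sum λ i → term A i j)
    expand det≈detᵀ A = +-congˡ (sum-cong-≋ λ j → begin
      (- 1#) ^ suc (toℕ j) * A zero (suc j) * det (minor A (suc j))
        ≈⟨ *-congˡ (det≈detᵀ (minor A (suc j))) ⟩
      (- 1#) ^ suc (toℕ j) * A zero (suc j) * det (minor A (suc j) ᵀ)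
        ≈⟨ *-congˡ (sum-cong-≋ {x = laplace (minor A (suc j) ᵀ)} {inner A j} λ i →
             *-congˡ {(- 1#) ^ toℕ i * A (suc i) zero} (sym (det-ᵀ (core A i j)))) ⟩
      (- 1#) ^ suc (toℕ j) * A zero (suc j) * sum (inner A j)
        ≈⟨ *-distribˡ-sum _ (inner A j) ⟩
      sum (λ i → term A i j) ∎)

    term-ᵀ : ∀ i j → term A i j ≈ term (A ᵀ) j i
    term-ᵀ i j = trans
      (solve 5 (λ p q a b d → :- con (+ 1) :* q :* a :* (p :* b :* d)
                            := :- con (+ 1) :* p :* b :* (q :* a :* d))
        refl ((- 1#) ^ toℕ i) ((- 1#) ^ toℕ j) (A zero (suc j)) (A (suc i) zero) (det (core A i j)))
      (*-congˡ (*-congˡ (det-ᵀ (core A i j))))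

  -- For row 0 the minors agree and the entries are linear; for a later row every minor is linear by
  -- induction. Agreement of three matrices off row `i` passes directly to minors, which is why no
  -- row update appears.
  det-linear : ∀ {n} {A B M : Matrix n} i x y →
    (∀ k → k ≢ i → A k ≐ M k) → (∀ k → k ≢ i → B k ≐ M k) →
    (∀ j → M i j ≈ x * A i j + y * B i j) →
    det M ≈ x * det A + y * det B
  det-linear {suc n} {A} {B} {M} i x y eA eB eC = begin
    sum (laplace M)
      ≈⟨ sum-cong-≋ {x = laplace M} (termwise i eA eB eC) ⟩
    sum (λ j → x * laplace A j + y * laplace B j)
      ≈⟨ ∑-distrib-+ (λ j → x * laplace A j) (λ j → y * laplace B j) ⟩
    sum (λ j → x * laplace A j) + sum (λ j → y * laplace B j)
      ≈⟨ +-cong (*-distribˡ-sum x (laplace A)) (*-distribˡ-sum y (laplace B)) ⟨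
    x * det A + y * det B ∎
    where
    termwise : ∀ i → (∀ k → k ≢ i → A k ≐ M k) → (∀ k → k ≢ i → B k ≐ M k) →
               (∀ j → M i j ≈ x * A i j + y * B i j) →
               ∀ j → laplace M j ≈ x * laplace A j + y * laplace B j
    termwise zero eA eB eC j = begin
      p * M zero j * det (minor M j)
        ≈⟨ *-congʳ (*-congˡ (eC j)) ⟩
      p * (x * A zero j + y * B zero j) * det (minor M j)
        ≈⟨ solve 6 (λ p x y a b d → p :* (x :* a :+ y :* b) :* d
                                  := x :* (p :* a :* d) :+ y :* (p :* b :* d))
             refl p x y (A zero j) (B zero j) (det (minor M j)) ⟩
      x * (p * A zero j * det (minor M j)) + y * (p * B zero j * det (minor M j))
        ≈⟨ +-cong (*-congˡ (*-congˡ (det-cong λ a b → eA (suc a) (λ ()) (punchIn j b))))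
                  (*-congˡ (*-congˡ (det-cong λ a b → eB (suc a) (λ ()) (punchIn j b)))) ⟨
      x * laplace A j + y * laplace B j ∎
      where
      p : Carrier
      p = (- 1#) ^ toℕ j
    termwise (suc i) eA eB eC j = begin
      p * M zero j * det (minor M j)
        ≈⟨ *-congˡ (det-linear i x y
             (λ k k≢i b → eA (suc k) (k≢i ∘ Fin.suc-injective) (punchIn j b))
             (λ k k≢i b → eB (suc k) (k≢i ∘ Fin.suc-injective) (punchIn j b))
             (λ b → eC (punchIn j b))) ⟩
      p * M zero j * (x * det (minor A j) + y * det (minor B j))
        ≈⟨ solve 6 (λ p x y c d e → p :* c :* (x :* d :+ y :* e)
                                  := x :* (p :* c :* d) :+ y :* (p :* c :* e))
             refl p x y (M zero j) (det (minor A j)) (det (minor B j)) ⟩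
      x * (p * M zero j * det (minor A j)) + y * (p * M zero j * det (minor B j))
        ≈⟨ +-cong (*-congˡ (*-congʳ (*-congˡ (eA zero (λ ()) j))))
                  (*-congˡ (*-congʳ (*-congˡ (eB zero (λ ()) j)))) ⟨
      x * laplace A j + y * laplace B j ∎
      where
      p : Carrier
      p = (- 1#) ^ toℕ j

  det-scaleRows : ∀ {n} (r : Fin n → Carrier) (A : Matrix n) →
                  det (λ i j → r i * A i j) ≈ product r * det A
  det-scaleRows {zero}  r A = sym (*-identityˡ 1#)
  det-scaleRows {suc n} r A = begin
    det (λ i j → r i * A i j)
      ≈⟨ (sum-cong-≋ {x = laplace (λ i j → r i * A i j)} λ j → trans
          (*-congˡ (det-scaleRows (r ∘ suc) (minor A j)))
           (solve 5 (λ p r a q d → p :* (r :* a) :* (q :* d) := r :* q :* (p :* a :* d))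
             refl ((- 1#) ^ toℕ j) (r zero) (A zero j) (product (r ∘ suc)) (det (minor A j)))) ⟩
    sum (λ j → product r * laplace A j)
      ≈⟨ *-distribˡ-sum _ (laplace A) ⟨
    product r * det A ∎

  det-scaleColumns : ∀ {n} (r : Fin n → Carrier) (A : Matrix n) →
                     det (λ i j → r j * A i j) ≈ product r * det A
  det-scaleColumns r A = begin
    det (λ i j → r j * A i j)       ≈⟨ det-ᵀ (λ i j → r j * A i j) ⟩
    det (λ i j → r i * (A ᵀ) i j)   ≈⟨ det-scaleRows r (A ᵀ) ⟩
    product r * det (A ᵀ)           ≈⟨ *-congˡ (det-ᵀ A) ⟨
    product r * det A               ∎

  swap₀₁ : ∀ {n} → Fin (suc (suc n)) → Fin (suc (suc n))
  swap₀₁ zero          = suc zero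
  swap₀₁ (suc zero)    = zero
  swap₀₁ (suc (suc i)) = suc (suc i)

  -- The first two terms of the expansion trade places and meet the opposite sign. Every later minor
  -- still begins with both columns, so it changes sign by induction.
  det-swapColumns : ∀ {n} (A : Matrix (suc (suc n))) → det (λ i j → A i (swap₀₁ j)) ≈ - det A
  det-swapColumns {n} A = begin
    det B
      ≈⟨ +-cong (*-congˡ (det-cong m₀)) (+-cong (*-congˡ (det-cong m₁)) (sum-cong-≋ m₂)) ⟩
    1# * a₁ * d₁ + (- 1# * 1# * a₀ * d₀ + sum (λ j → - 1# * rest j))
      ≈⟨ +-congˡ (+-congˡ (*-distribˡ-sum (- 1#) rest)) ⟨
    1# * a₁ * d₁ + (- 1# * 1# * a₀ * d₀ + - 1# * sum rest)
      ≈⟨ solve 5 (λ a₀ d₀ a₁ d₁ r → let one = con (+ 1) in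
            one :* a₁ :* d₁ :+ (:- one :* one :* a₀ :* d₀ :+ :- one :* r)
            := :- (one :* a₀ :* d₀ :+ (:- one :* one :* a₁ :* d₁ :+ r)))
          refl a₀ d₀ a₁ d₁ (sum rest) ⟩
    - det A ∎
    where
    B : Matrix (suc (suc n))
    B i j = A i (swap₀₁ j)
    a₀ a₁ d₀ d₁ : Carrier
    a₀ = A zero zero
    a₁ = A zero (suc zero)
    d₀ = det (minor A zero)
    d₁ = det (minor A (suc zero))
    rest : Fin n → Carrier
    rest j = laplace A (suc (suc j))

    m₀ : ∀ i → minor B zero i ≐ minor A (suc zero) i
    m₀ i zero    = refl
    m₀ i (suc k) = refl
    m₁ : ∀ i → minor B (suc zero) i ≐ minor A zero i
    m₁ i zero    = refl
    m₁ i (suc k) = refl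
    swap-minor : ∀ {n} (A : Matrix (suc (suc n))) (j : Fin n) →
      det (minor (λ i j → A i (swap₀₁ j)) (suc (suc j))) ≈ - det (minor A (suc (suc j)))
    swap-minor {suc n} A j = trans
      (det-cong {A = minor (λ i j → A i (swap₀₁ j)) (suc (suc j))}
                {λ i k → minor A (suc (suc j)) i (swap₀₁ k)}
        λ { i zero → refl ; i (suc zero) → refl ; i (suc (suc k)) → refl })
      (det-swapColumns (minor A (suc (suc j))))
    m₂ : ∀ j → laplace B (suc (suc j)) ≈ - 1# * rest j
    m₂ j = trans (*-congˡ (swap-minor A j))
      (solve 3 (λ p a d → p :* a :* :- d := :- con (+ 1) :* (p :* a :* d)) refl _ _ _)

  det-swapRows : ∀ {n} (A : Matrix (suc (suc n))) → det (λ i → A (swap₀₁ i)) ≈ - det A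
  det-swapRows A = begin
    det (λ i → A (swap₀₁ i))            ≈⟨ det-ᵀ (λ i → A (swap₀₁ i)) ⟩
    det (λ i j → (A ᵀ) i (swap₀₁ j))    ≈⟨ det-swapColumns (A ᵀ) ⟩
    - det (A ᵀ)                         ≈⟨ -‿cong (det-ᵀ A) ⟨
    - det A                             ∎

-- Linear combinations of rows, alternation, and the Vandermonde determinant.

module RowOperations {c ℓ} (K : Field c ℓ) where
  open Field K hiding (zero)
  open OverField K
  open IntegerCoefficients commutativeRing using (solve; _:=_; _:+_; _:*_; _:-_; :-_; con)
  open SetoidReasoning setoid
  open SemiringSums semiring using (sum; sum-cong-≋; sum-replicate-zero)
  open CommutativeMonoidSums *-commutativeMonoid using () renaming (sum to product; sum-cong-≋ to product-cong)
  open FieldProperties K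
  open Determinants K

  -- Finite linear combinations of the `v i` with `P i`. Both constructors hold up to pointwise
  -- equality, so functions need not coincide. `X` is left open to cover matrix rows, infinite
  -- sequences and polynomial functions alike.
  data Span {x} {X : Set x} {I : Set} (P : I → Set) (v : I → X → Carrier) : (X → Carrier) →
      Set (x ⊔ c ⊔ ℓ) where
    none : ∀ {w} → (∀ x → w x ≈ 0#) → Span P v w
    plus : ∀ {w w′} a i → P i → Span P v w → (∀ x → w′ x ≈ w x + a * v i x) → Span P v w′

  span-resp : ∀ {x} {X : Set x} {I P v} {w w′ : X → Carrier} → w ≐ w′ → Span {I = I} P v w → Span P v w′
  span-resp e (none z)          = none λ x → trans (sym (e x)) (z x)
  span-resp e (plus a i p σ eq) = plus a i p σ λ x → trans (sym (e x)) (eq x)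

  span-+ : ∀ {x} {X : Set x} {I P v} {w w′ : X → Carrier} →
           Span {I = I} P v w → Span P v w′ → Span P v (λ x → w x + w′ x)
  span-+ σ (none z) = span-resp (λ x → sym (trans (+-congˡ (z x)) (+-identityʳ _))) σ
  span-+ σ (plus a i p τ eq) = plus a i p (span-+ σ τ)
    λ x → trans (+-congˡ (eq x)) (sym (+-assoc _ _ _))

  span-generator : ∀ {x} {X : Set x} {I P} {v : I → X → Carrier} a i → P i → Span P v (λ x → a * v i x)
  span-generator a i p = plus a i p (none λ _ → refl) λ x → sym (+-identityˡ _)

  span-* : ∀ {x} {X : Set x} {I P v} {w : X → Carrier} b → Span {I = I} P v w → Span P v (λ x → b * w x)
  span-* b (none z)          = none λ x → trans (*-congˡ (z x)) (zeroʳ b)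
  span-* b (plus a i p σ eq) = plus (b * a) i p (span-* b σ) λ x →
    trans (*-congˡ (eq x)) (trans (distribˡ b _ _) (+-congˡ (sym (*-assoc b a _))))

  -- Multiplying by `f` and substituting `g` is linear, so generators suffice. It serves for
  -- multiplication by x - z, for evaluation at points, and for shifting a sequence.
  span-map : ∀ {x y} {X : Set x} {Y : Set y} {I J P Q} {v : I → X → Carrier} {u : J → Y → Carrier}
             (f : Y → Carrier) (g : Y → X) →
             (∀ i → P i → Span Q u (λ y → f y * v i (g y))) →
             ∀ {w} → Span P v w → Span Q u (λ y → f y * w (g y))
  span-map f g h (none z) = none λ y → trans (*-congˡ (z (g y))) (zeroʳ _)
  span-map {v = v} f g h (plus {w} a i p σ eq) =
    span-resp (λ y → sym (trans (*-congˡ (eq (g y)))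
        (solve 4 (λ f w a v → f :* (w :+ a :* v) := f :* w :+ a :* (f :* v))
            refl (f y) (w (g y)) a (v i (g y)))))
      (span-+ (span-map f g h σ) (span-* a (h i p)))

  span-⊆ : ∀ {x} {X : Set x} {I J P Q} {v : I → X → Carrier} {u : J → X → Carrier} →
           (∀ i → P i → ∃ λ j → Q j × v i ≐ u j) → ∀ {w} → Span P v w → Span Q u w
  span-⊆ h (none z) = none z
  span-⊆ h (plus a i p σ eq) with h i p
  ... | j , q , e = plus a j q (span-⊆ h σ) λ x → trans (eq x) (+-congˡ (*-congˡ (e x)))

  -- The Newton basis polynomial of degree `m` with roots -y₀, ..., -yₘ₋₁.
  Π : (ℕ → Carrier) → ℕ → Carrier → Carrier
  Π y zero    x = 1#
  Π y (suc m) x = (x + y m) * Π y m x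

  -- The Vandermonde product, oriented with the earlier point first in every factor; the signs below
  -- depend on this.
  differences : ∀ {n} → (Fin n → Carrier) → Carrier
  differences {zero}  x = 1#
  differences {suc n} x = product (λ j → x zero - x (suc j)) * differences (x ∘ suc)

  -- Induction on the roots, using (x - z) Πᵢ = Πᵢ₊₁ + (- z - yᵢ) Πᵢ. Membership in the span of the
  -- lower `Π y i` stands in for a bound on the degree.
  newton-expansion : ∀ {n} (y : ℕ → Carrier) (z : Fin n → Carrier) →
    ∃ λ w → Span (ℕ._< n) (Π y) w × (∀ x → product (λ j → x - z j) ≈ Π y n x + w x)
  newton-expansion {zero}  y z = (λ _ → 0#) , none (λ _ → refl) , λ x → sym (+-identityʳ 1#)
  newton-expansion {suc n} y z with newton-expansion y (z ∘ suc)
  ... | w , σ , eq = w′ , σ′ , λ x → trans (*-congˡ (eq x))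
        (solve 5 (λ x z y p w → (x :- z) :* (p :+ w)
            := (x :+ y) :* p :+ ((:- z :- y) :* p :+ (x :- z) :* w)) refl
           x (z zero) (y n) (Π y n x) (w x))
    where
    w′ : Carrier → Carrier
    w′ x = (- z zero - y n) * Π y n x + (x - z zero) * w x
    step : ∀ i → i ℕ.< n → Span (ℕ._< suc n) (Π y) (λ x → (x - z zero) * Π y i x)
    step i i<n = span-resp
      (λ x → solve 4 (λ x z y p → con (+ 1) :* ((x :+ y) :* p) :+ (:- z :- y) :* p := (x :- z) :* p) refl
               x (z zero) (y i) (Π y i x))
      (span-+ (span-generator 1# (suc i) (ℕ.s≤s i<n))
              (span-generator (- z zero - y i) i (ℕ.m<n⇒m<1+n i<n)))
    σ′ : Span (ℕ._< suc n) (Π y) w′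
    σ′ = span-+ (span-generator _ n (ℕ.n<1+n n)) (span-map _ (λ x → x) step σ)

  product-zero : ∀ {n} (f : Fin n → Carrier) k → f k ≈ 0# → product f ≈ 0#
  product-zero f zero    e = trans (*-congʳ e) (zeroˡ _)
  product-zero f (suc k) e = trans (*-congˡ (product-zero (f ∘ suc) k e)) (zeroʳ _)

  module _ (2≉0 : ¬ (1# + 1# ≈ 0#)) where

    -- Exchanging two equal rows only gives det = - det; cancelling 2 turns this into vanishing.
    self-negative⇒≈0 : ∀ {x} → x ≈ - x → x ≈ 0#
    self-negative⇒≈0 {x} e = *-cancelˡ 2≉0 (begin
      (1# + 1#) * x    ≈⟨ solve 1 (λ x → (con (+ 1) :+ con (+ 1)) :* x := x :+ x) refl x ⟩
      x + x            ≈⟨ +-congˡ e ⟩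
      x - x            ≈⟨ solve 1 (λ x → x :- x := (con (+ 1) :+ con (+ 1)) :* con (+ 0)) refl x ⟩
      (1# + 1#) * 0#   ∎)

    sum-zero : ∀ {n} (f : Fin n → Carrier) → (∀ i → f i ≈ 0#) → sum f ≈ 0#
    sum-zero {n} f e = trans (sum-cong-≋ {x = f} {λ _ → 0#} e) (sum-replicate-zero n)

    mutual
      -- Equal rows below row 0 survive in every minor, where induction applies. If row 0 is one of
      -- them, exchanging rows 0 and 1 either fixes the matrix or moves the pair below row 0.
      det-alternating : ∀ {n} (A : Matrix n) {i k} → i ≢ k → A i ≐ A k → det A ≈ 0#
      det-alternating A {zero}  {zero}          i≢k e = contradiction ≡.refl i≢k
      det-alternating A {suc i} {suc k}         i≢k e = det-alternatingMinors A (i≢k ∘ ≡.cong suc) e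
      det-alternating A {zero}  {suc k}         i≢k e = det-alternating₀ A k e
      det-alternating A {suc i} {zero}          i≢k e = det-alternating₀ A i (λ j → sym (e j))

      det-alternatingMinors : ∀ {n} (A : Matrix (suc n)) {i k} → i ≢ k → A (suc i) ≐ A (suc k) → det A ≈ 0#
      det-alternatingMinors A i≢k e = sum-zero (laplace A) λ j →
        trans (*-congˡ (det-alternating (minor A j) i≢k (λ l → e (punchIn j l)))) (zeroʳ _)

      det-alternating₀ : ∀ {n} (A : Matrix (suc n)) k → A zero ≐ A (suc k) → det A ≈ 0#
      det-alternating₀ {suc n} A zero e = self-negative⇒≈0 (begin
        det A
          ≈⟨ det-cong {A = A} {λ i → A (swap₀₁ i)} (λ { zero → e ; (suc zero) j →
              sym (e j) ; (suc (suc i)) j → refl }) ⟩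
        det (λ i → A (swap₀₁ i))   ≈⟨ det-swapRows A ⟩
        - det A                    ∎)
      det-alternating₀ {suc n} A (suc k) e = begin
        det A                        ≈⟨ solve 1 (λ d → d := :- :- d) refl _ ⟩
        - - det A                    ≈⟨ -‿cong (det-swapRows A) ⟨
        - det (λ i → A (swap₀₁ i))
          ≈⟨ -‿cong (det-alternatingMinors (λ i → A (swap₀₁ i)) {zero} {suc k} (λ ()) e) ⟩
        - 0#                         ≈⟨ solve 0 (:- con (+ 0) := con (+ 0)) refl ⟩
        0#                           ∎

    -- Induction on the combination: linearity in row `i` splits off one term, and the matrix of
    -- that term contains `A k` twice.
    det-spanned : ∀ {n} (A B : Matrix n) i → (∀ k → k ≢ i → B k ≐ A k) →
                  ∀ {w} → Span (_≢ i) A w → B i ≐ w → det B ≈ 0#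
    det-spanned A B i e (none z) Bᵢ = begin
      -- A zero row is `0#` times itself plus `0#` times itself, so linearity applies with all three
      -- matrices equal to `B`.
      det B                     ≈⟨ det-linear {A = B} {B} i 0# 0# (λ _ _ _ → refl) (λ _ _ _ → refl)
                                     (λ j → trans (trans (Bᵢ j) (z j)) (solve 1 (λ b → con (+ 0)
                                         := con (+ 0) :* b :+ con (+ 0) :* b) refl (B i j))) ⟩
      0# * det B + 0# * det B
        ≈⟨ solve 1 (λ b → con (+ 0) :* b :+ con (+ 0) :* b := con (+ 0)) refl (det B) ⟩
      0#                        ∎
    det-spanned A B i e (plus {w = w} a k k≢i σ eq) Bᵢ = begin
      det B
        ≈⟨ det-linear {A = B₁} {B₂} {B} i 1# a B₁-minimal B₂-minimal (λ j → begin
             B i j                      ≈⟨ trans (Bᵢ j) (eq j) ⟩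
             w j + a * A k j            ≈⟨ +-congʳ (*-identityˡ _) ⟨
             1# * w j + a * A k j       ≡⟨ ≡.cong₂ (λ p q → 1# * p j + a * q j)
                                             (updateAt-updates i B) (updateAt-updates i B) ⟨
             1# * B₁ i j + a * B₂ i j   ∎) ⟩
      1# * det B₁ + a * det B₂
        ≈⟨ +-cong (*-congˡ (det-spanned A B₁ i
             (λ l l≢i j → trans (B₁-minimal l l≢i j) (e l l≢i j))
             σ (λ j → reflexive (≡.cong (λ p → p j) (updateAt-updates i B)))))
           (*-congˡ (det-alternating B₂ k≢i λ j → trans (trans (B₂-minimal k k≢i j) (e k k≢i j))
              (reflexive (≡.cong (λ p → p j) (≡.sym (updateAt-updates i B)))))) ⟩
      1# * 0# + a * 0#
        ≈⟨ solve 1 (λ a → con (+ 1) :* con (+ 0) :+ a :* con (+ 0) := con (+ 0)) refl a ⟩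
      0# ∎
      where
      B₁ B₂ : Matrix _
      B₁ = updateAt B i (const w)
      B₂ = updateAt B i (const (A k))
      B₁-minimal : ∀ l → l ≢ i → B₁ l ≐ B l
      B₁-minimal l l≢i j = reflexive (≡.cong (λ p → p j) (updateAt-minimal l i B l≢i))
      B₂-minimal : ∀ l → l ≢ i → B₂ l ≐ B l
      B₂-minimal l l≢i j = reflexive (≡.cong (λ p → p j) (updateAt-minimal l i B l≢i))

    det-addSpanned : ∀ {n} (A B : Matrix n) i → (∀ k → k ≢ i → B k ≐ A k) →
                     ∀ {w} → Span (_≢ i) A w → (∀ j → B i j ≈ A i j + w j) → det B ≈ det A
    det-addSpanned A B i e {w} σ eq = begin
      det B                     ≈⟨ det-linear {A = A} {M} {B} i 1# 1#
                                     (λ l l≢i j → sym (e l l≢i j)) (λ l l≢i j →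
                                         trans (M-minimal l l≢i j) (sym (e l l≢i j)))
                                     (λ j → begin
             B i j                      ≈⟨ eq j ⟩
             A i j + w j                ≈⟨ +-cong (*-identityˡ _) (*-identityˡ _) ⟨
             1# * A i j + 1# * w j      ≡⟨ ≡.cong (λ p → 1# * A i j + 1# * p j) (updateAt-updates i A) ⟨
             1# * A i j + 1# * M i j    ∎) ⟩
      1# * det A + 1# * det M   ≈⟨ +-congˡ (*-congˡ (det-spanned A M i M-minimal
             σ (λ j → reflexive (≡.cong (λ p → p j) (updateAt-updates i A))))) ⟩
      1# * det A + 1# * 0#      ≈⟨ solve 1 (λ a → con (+ 1) :* a :+ con (+ 1) :* con (+ 0) := a) refl _ ⟩
      det A                     ∎
      where
      M : Matrix _
      M = updateAt A i (const w)
      M-minimal : ∀ l → l ≢ i → M l ≐ A l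
      M-minimal l l≢i j = reflexive (≡.cong (λ p → p j) (updateAt-minimal l i A l≢i))

    -- The rows are exchanged one at a time, the last one first: the correction to a row involves
    -- earlier rows of `A`, and those are then still in place.
    det-unitriangular : ∀ {n} (A B : Matrix n) →
      (∀ i → ∃ λ w → Span (λ k → toℕ k ℕ.< toℕ i) A w × (∀ j → B i j ≈ A i j + w j)) →
      det B ≈ det A
    det-unitriangular {n} A B h = sym (hybrid n ℕ.≤-refl A (λ k k<n j → refl)
                                    (λ k n≤k → contradiction (Fin.toℕ<n k) (ℕ.≤⇒≯ n≤k)))
      where
      hybrid : ∀ m → m ℕ.≤ n → (M : Matrix n) →
               (∀ k → toℕ k ℕ.< m → M k ≐ A k) → (∀ k → m ℕ.≤ toℕ k → M k ≐ B k) → det M ≈ det B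
      hybrid zero    m≤n M low high = det-cong λ k → high k ℕ.z≤n
      hybrid (suc m) m<n M low high with h (fromℕ< m<n)
      ... | w , σ , eq = begin
        det M
          ≈⟨ det-addSpanned M M′ i (λ k k≢i j → reflexive (≡.cong (λ p → p j) (updateAt-minimal k i M k≢i)))
                      (span-⊆ (λ k k<i → k , (λ k≡i → ℕ.<-irrefl (≡.cong toℕ k≡i) k<i) ,
                                λ j → sym (low k (ℕ.m<n⇒m<1+n (≡.subst (toℕ k ℕ.<_) i≡m k<i)) j)) σ)
                      (λ j → begin
                        M′ i j          ≡⟨ ≡.cong (λ p → p j) (updateAt-updates i M) ⟩
                        B i j           ≈⟨ eq j ⟩
                        A i j + w j     ≈⟨ +-congʳ (low i (ℕ.≤-reflexive (≡.cong suc i≡m)) j) ⟨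
                        M i j + w j     ∎) ⟨
        det M′   ≈⟨ hybrid m (ℕ.<⇒≤ m<n) M′
                      (λ k k<m j → trans (reflexive (≡.cong (λ p → p j) (updateAt-minimal k i M λ k≡i →
                                     ℕ.<-irrefl (≡.trans (≡.cong toℕ k≡i) i≡m) k<m)))
                                   (low k (ℕ.m<n⇒m<1+n k<m) j))
                      high′ ⟩
        det B    ∎
        where
        i : Fin n
        i = fromℕ< m<n
        i≡m : toℕ i ≡ m
        i≡m = Fin.toℕ-fromℕ< m<n
        M′ : Matrix n
        M′ = updateAt M i (const (B i))
        high′ : ∀ k → m ℕ.≤ toℕ k → M′ k ≐ B k
        high′ k m≤k j with k Fin.≟ i
        ... | yes ≡.refl = reflexive (≡.cong (λ p → p j) (updateAt-updates i M))
        ... | no  k≢i    = trans (reflexive (≡.cong (λ p → p j) (updateAt-minimal k i M k≢i)))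
          (high k (ℕ.≤∧≢⇒< m≤k λ m≡k → k≢i (Fin.toℕ-injective (≡.trans (≡.sym m≡k) (≡.sym i≡m)))) j)

    -- Adding lower rows turns row 0 into the monic polynomial that vanishes at every point but the
    -- first, so that only one term of the expansion survives.
    det-Π : ∀ n (y : ℕ → Carrier) (x : Fin n → Carrier) →
            det (λ i j → Π y (n ∸ suc (toℕ i)) (x j)) ≈ differences x
    det-Π zero    y x = refl
    det-Π (suc n) y x with newton-expansion y (x ∘ suc)
    ... | w , σ , eq = begin
      det A   ≈⟨ det-addSpanned A B zero (λ { zero 0≢0 → contradiction ≡.refl 0≢0 ; (suc k) _ j → refl })
                   (span-map (λ _ → 1#) x generators σ)
                   (λ j → trans (eq (x j)) (+-congˡ (sym (*-identityˡ _)))) ⟨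
      det B   ≈⟨ +-cong (*-cong (*-identityˡ _) (det-Π n y (x ∘ suc)))
                   (sum-zero (laplace B ∘ suc) λ j →
                     trans (*-congʳ (trans (*-congˡ (product-zero (λ k →
                         x (suc j) - x (suc k)) j (-‿inverseʳ _)))
                                           (zeroʳ _))) (zeroˡ _)) ⟩
      differences x + 0#   ≈⟨ +-identityʳ _ ⟩
      differences x        ∎
      where
      A B : Matrix (suc n)
      A i j = Π y (n ∸ toℕ i) (x j)
      B zero    j = product (λ k → x j - x (suc k))
      B (suc i) j = A (suc i) j
      generators : ∀ m → m ℕ.< n → Span (_≢ zero) A (λ j → 1# * Π y m (x j))
      generators m m<n = span-resp
        (λ j → *-congˡ (reflexive (≡.cong (λ k → Π y k (x j)) (≡.trans
          (≡.sym (Fin.opposite-prop (opposite k)))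
          (≡.trans (≡.cong toℕ (Fin.opposite-involutive k)) (Fin.toℕ-fromℕ< m<n))))))
        (span-generator 1# (suc (opposite k)) (λ ()))
        where
        k : Fin n
        k = fromℕ< m<n

-- Halving of indices, finite products, signs and factorials.

-- Unlike `2 ℕ.* n`, this unfolds by two successors at a time, in step with `⌊_/2⌋` and with
-- recursions that descend by two.
double : ℕ → ℕ
double zero    = zero
double (suc n) = suc (suc (double n))

2*≡double : ∀ n → 2 ℕ.* n ≡ double n
2*≡double zero    = ≡.refl
2*≡double (suc n) = ≡.cong suc (≡.trans (ℕ.+-suc n (n ℕ.+ 0)) (≡.cong suc (2*≡double n)))

⌊double/2⌋ : ∀ n → ⌊ double n /2⌋ ≡ n
⌊double/2⌋ zero    = ≡.refl
⌊double/2⌋ (suc n) = ≡.cong suc (⌊double/2⌋ n)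

⌊1+double/2⌋ : ∀ n → ⌊ suc (double n) /2⌋ ≡ n
⌊1+double/2⌋ zero    = ≡.refl
⌊1+double/2⌋ (suc n) = ≡.cong suc (⌊1+double/2⌋ n)

⌈n/2⌉≡⌊n/2⌋⊎1+⌊n/2⌋ : ∀ n → ⌈ n /2⌉ ≡ ⌊ n /2⌋ ⊎ ⌈ n /2⌉ ≡ suc ⌊ n /2⌋
⌈n/2⌉≡⌊n/2⌋⊎1+⌊n/2⌋ zero          = inj₁ ≡.refl
⌈n/2⌉≡⌊n/2⌋⊎1+⌊n/2⌋ (suc zero)    = inj₂ ≡.refl
⌈n/2⌉≡⌊n/2⌋⊎1+⌊n/2⌋ (suc (suc n)) = Sum.map (≡.cong suc) (≡.cong suc) (⌈n/2⌉≡⌊n/2⌋⊎1+⌊n/2⌋ n)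

[1+n]C2≡n+nC2 : ∀ n → suc n C 2 ≡ n ℕ.+ n C 2
[1+n]C2≡n+nC2 n = ≡.trans (≡.sym (nCk+nC[k+1]≡[n+1]C[k+1] n 1)) (≡.cong (ℕ._+ n C 2) (nC1≡n n))

module Products {c ℓ} (K : Field c ℓ) where
  open Field K hiding (zero)
  open OverField K
  open IntegerCoefficients commutativeRing using (solve; _:=_; _:+_; _:*_; _:-_; :-_; con)
  open SetoidReasoning setoid
  open CommutativeMonoidSums *-commutativeMonoid using (∑-comm; ∑-distrib-+) renaming (sum to product; sum-cong-≋ to product-cong)
  open SemiringMult semiring using (×1-homo-*; ×-homo-+)
  open SemiringExp semiring using (^-homo-*; ^-congˡ)
  open CommutativeSemiringExp commutativeSemiring using (^-distrib-*)
  open FieldProperties K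

  ∏ : ℕ → (ℕ → Carrier) → Carrier
  ∏ = ∏-syntax

  ∏-cong : ∀ n f g → (∀ i → i ℕ.< n → f i ≈ g i) → ∏ n f ≈ ∏ n g
  ∏-cong n f g e = product-cong {x = f ∘ toℕ} {g ∘ toℕ} λ i → e (toℕ i) (Fin.toℕ<n i)

  ∏-* : ∀ n f g → ∏ n (λ i → f i * g i) ≈ ∏ n f * ∏ n g
  ∏-* n f g = ∑-distrib-+ {n} (f ∘ toℕ) (g ∘ toℕ)

  ∏-comm : ∀ m n (f : ℕ → ℕ → Carrier) → ∏ m (λ i → ∏ n (f i)) ≈ ∏ n (λ j → ∏ m (λ i → f i j))
  ∏-comm m n f = ∑-comm {m} {n} λ i j → f (toℕ i) (toℕ j)

  ∏-last : ∀ n f → ∏ (suc n) f ≈ ∏ n f * f n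
  ∏-last zero    f = *-comm _ _
  ∏-last (suc n) f = trans (*-congˡ (∏-last n (f ∘ suc))) (sym (*-assoc _ _ _))

  ∏-const : ∀ n x → ∏ n (λ _ → x) ≈ x ^ n
  ∏-const zero    x = refl
  ∏-const (suc n) x = *-congˡ (∏-const n x)

  ∏-neg : ∀ n f → ∏ n (λ i → - f i) ≈ (- 1#) ^ n * ∏ n f
  ∏-neg n f = begin
    ∏ n (λ i → - f i)
      ≈⟨ ∏-cong n (λ i → - f i) (λ i → - 1# * f i) (λ i _ → solve 1 (λ x → :- x := :- con (+ 1) :* x)
          refl (f i)) ⟩
    ∏ n (λ i → - 1# * f i)           ≈⟨ ∏-* n (λ _ → - 1#) f ⟩
    ∏ n (λ _ → - 1#) * ∏ n f         ≈⟨ *-congʳ (∏-const n (- 1#)) ⟩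
    (- 1#) ^ n * ∏ n f               ∎

  -- Removing the first factor exchanges even and odd positions, just as `⌈ suc n /2⌉` reduces to
  -- `suc ⌊ n /2⌋` and `⌊ suc n /2⌋` to `⌈ n /2⌉`.
  ∏-interleave : ∀ n h → ∏ n h ≈ ∏ ⌈ n /2⌉ (h ∘ double) * ∏ ⌊ n /2⌋ (h ∘ suc ∘ double)
  ∏-interleave zero    h = sym (*-identityʳ _)
  ∏-interleave (suc n) h = begin
    h 0 * ∏ n (h ∘ suc)
      ≈⟨ *-congˡ (∏-interleave n (h ∘ suc)) ⟩
    h 0 * (∏ ⌈ n /2⌉ (h ∘ suc ∘ double) * ∏ ⌊ n /2⌋ (h ∘ double ∘ suc))
      ≈⟨ solve 3 (λ x y z → x :* (y :* z) := x :* z :* y) refl _ _ _ ⟩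
    h 0 * ∏ ⌊ n /2⌋ (h ∘ double ∘ suc) * ∏ ⌈ n /2⌉ (h ∘ suc ∘ double)           ∎

  sign² : ∀ n → (- 1#) ^ n * (- 1#) ^ n ≈ 1#
  sign² zero    = *-identityʳ 1#
  sign² (suc n) = trans (solve 1 (λ x → (:- con (+ 1) :* x) :* (:- con (+ 1) :* x) := x :* x)
      refl ((- 1#) ^ n)) (sign² n)

  sign-n*n : ∀ n → (- 1#) ^ (n ℕ.* n) ≈ (- 1#) ^ n
  sign-n*n zero    = refl
  sign-n*n (suc n) = *-congˡ (begin
    (- 1#) ^ (n ℕ.+ n ℕ.* suc n)                         ≡⟨ ≡.cong ((- 1#) ^_) (nat n) ⟩
    (- 1#) ^ (n ℕ.+ n ℕ.+ n ℕ.* n)                       ≈⟨ ^-homo-* (- 1#) (n ℕ.+ n) (n ℕ.* n) ⟩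
    (- 1#) ^ (n ℕ.+ n) * (- 1#) ^ (n ℕ.* n)
      ≈⟨ *-cong (trans (^-homo-* (- 1#) n n) (sign² n)) (sign-n*n n) ⟩
    1# * (- 1#) ^ n                                      ≈⟨ *-identityˡ _ ⟩
    (- 1#) ^ n                                           ∎)
    where
    nat : ∀ n → n ℕ.+ n ℕ.* suc n ≡ n ℕ.+ n ℕ.+ n ℕ.* n
    nat = solve-∀

  sgn : ℕ → Carrier
  sgn n = (- 1#) ^ (⌈ n /2⌉ C 2)

  -- For n = 2b the binomial grows by b, which has the parity of b². For n = 2b+1 it is unchanged,
  -- and b(b+1) is even.
  sgn-suc : ∀ n → sgn (suc n) ≈ sgn n * (- 1#) ^ (⌈ n /2⌉ ℕ.* ⌊ n /2⌋)
  sgn-suc n with ⌈ n /2⌉ | ⌊ n /2⌋ | ⌈n/2⌉≡⌊n/2⌋⊎1+⌊n/2⌋ n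
  ... | _ | b | inj₁ ≡.refl = begin
    (- 1#) ^ (suc b C 2)                   ≡⟨ ≡.cong ((- 1#) ^_) ([1+n]C2≡n+nC2 b) ⟩
    (- 1#) ^ (b ℕ.+ b C 2)                 ≈⟨ ^-homo-* (- 1#) b (b C 2) ⟩
    (- 1#) ^ b * (- 1#) ^ (b C 2)          ≈⟨ *-comm _ _ ⟩
    (- 1#) ^ (b C 2) * (- 1#) ^ b          ≈⟨ *-congˡ (sign-n*n b) ⟨
    (- 1#) ^ (b C 2) * (- 1#) ^ (b ℕ.* b)  ∎
  ... | _ | b | inj₂ ≡.refl = begin
    (- 1#) ^ (suc b C 2)                               ≈⟨ *-identityʳ _ ⟨
    (- 1#) ^ (suc b C 2) * 1#                          ≈⟨ *-congˡ (trans (^-homo-* (- 1#) b (b ℕ.* b))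
                                                            (trans (*-congˡ (sign-n*n b)) (sign² b))) ⟨
    (- 1#) ^ (suc b C 2) * (- 1#) ^ (suc b ℕ.* b)      ∎

  fromℕ-+ : ∀ m n → fromℕ (m ℕ.+ n) ≈ fromℕ m + fromℕ n
  fromℕ-+ = ×-homo-+ 1#

  fromℕ-* : ∀ m n → fromℕ (m ℕ.* n) ≈ fromℕ m * fromℕ n
  fromℕ-* = ×1-homo-*

  superfactorial : ℕ → Carrier
  superfactorial n = ∏[ i < n ] fromℕ (i !)

  falling-factorial : ∀ a b → ∏[ c < b ] (fromℕ (b ℕ.+ a) - fromℕ c) * fromℕ (a !) ≈ fromℕ ((b ℕ.+ a) !)
  falling-factorial a zero    = *-identityˡ _
  falling-factorial a (suc b) = begin
    (1# + N - 0#) * ∏[ c < b ] (1# + N - (1# + fromℕ c)) * fromℕ (a !)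
      ≈⟨ *-congʳ (*-cong (solve 1 (λ x → x :- con (+ 0) := x) refl (1# + N))
           (∏-cong b (λ c → 1# + N - (1# + fromℕ c)) (λ c → N - fromℕ c) λ c _ →
             solve 2 (λ x y → con (+ 1) :+ x :- (con (+ 1) :+ y) := x :- y) refl N (fromℕ c))) ⟩
    (1# + N) * ∏[ c < b ] (N - fromℕ c) * fromℕ (a !)
      ≈⟨ trans (*-assoc _ _ _) (*-congˡ (falling-factorial a b)) ⟩
    (1# + N) * fromℕ ((b ℕ.+ a) !)
      ≈⟨ fromℕ-* (suc (b ℕ.+ a)) ((b ℕ.+ a) !) ⟨
    fromℕ (suc (b ℕ.+ a) !) ∎
    where
    N : Carrier
    N = fromℕ (b ℕ.+ a)

  -- For n = a+b this is the hook length of cell (r,c), counted from 0, in an a by b rectangle. The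
  -- unsimplified form matches the denominators of the theorem.
  hook : ℕ → ℕ → ℕ → Carrier
  hook n r c = fromℕ n - fromℕ (suc r) - fromℕ (suc c) + 1#

  -- The top row of an a+1 by b rectangle has hook product (a+b)!/a!, and the rows below it form an
  -- a by b rectangle with the same hooks.
  superfactorial-+ : ∀ a b →
    superfactorial (a ℕ.+ b) ≈ superfactorial a * superfactorial b * ∏[ r < a ] ∏[ c < b ] hook (a ℕ.+ b) r c
  superfactorial-+ zero    b = solve 1 (λ x → x := con (+ 1) :* x :* con (+ 1)) refl (superfactorial b)
  superfactorial-+ (suc a) b = begin
    superfactorial (suc (a ℕ.+ b))
      ≈⟨ ∏-last (a ℕ.+ b) (λ i → fromℕ (i !)) ⟩
    superfactorial (a ℕ.+ b) * fromℕ ((a ℕ.+ b) !)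
      ≈⟨ *-cong (superfactorial-+ a b)
           (trans (reflexive (≡.cong (λ n → fromℕ (n !)) (ℕ.+-comm a b))) (sym (falling-factorial a b))) ⟩
    superfactorial a * superfactorial b * H * (∏[ c < b ] (fromℕ (b ℕ.+ a) - fromℕ c) * fromℕ (a !))
      ≈⟨ solve 5 (λ x y z u v → x :* y :* z :* (u :* v) := x :* v :* y :* (u :* z)) refl
           (superfactorial a) (superfactorial b) H (∏[ c < b ] (fromℕ (b ℕ.+ a) - fromℕ c)) (fromℕ (a !)) ⟩
    superfactorial a * fromℕ (a !) * superfactorial b * (∏[ c < b ] (fromℕ (b ℕ.+ a) - fromℕ c) * H)
      ≈⟨ *-cong (*-congʳ (sym (∏-last a (λ i → fromℕ (i !)))))
           (*-cong
             (∏-cong b (λ c → fromℕ (b ℕ.+ a) - fromℕ c) (hook (suc (a ℕ.+ b)) 0) λ c _ →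
               trans (+-congʳ (reflexive (≡.cong fromℕ (ℕ.+-comm b a))))
                 (solve 2 (λ x y → x :- y
                     := con (+ 1) :+ x :- (con (+ 1) :+ con (+ 0)) :- (con (+ 1) :+ y) :+ con (+ 1)) refl
                   (fromℕ (a ℕ.+ b)) (fromℕ c)))
             (∏-cong a (λ r → ∏ b (hook (a ℕ.+ b) r)) (λ r → ∏ b (hook (suc (a ℕ.+ b)) (suc r))) λ r _ →
               ∏-cong b (hook (a ℕ.+ b) r) (hook (suc (a ℕ.+ b)) (suc r)) λ c _ →
                 solve 3 (λ x y z → x :- y :- z :+ con (+ 1)
                     := con (+ 1) :+ x :- (con (+ 1) :+ y) :- z :+ con (+ 1)) refl
                   (fromℕ (a ℕ.+ b)) (fromℕ (suc r)) (fromℕ (suc c)))) ⟩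
    superfactorial (suc a) * superfactorial b * ∏[ r < suc a ] ∏[ c < b ] hook (suc (a ℕ.+ b)) r c ∎
    where
    H : Carrier
    H = ∏[ r < a ] ∏[ c < b ] hook (a ℕ.+ b) r c

  -- The witness is the number of cells beyond (r,c) in its row and column. Positivity makes the
  -- divisions in the double product legitimate in characteristic 0.
  hook≈ : ∀ {a b r c} → r ℕ.< a → c ℕ.< b → ∃ λ k → hook (a ℕ.+ b) r c ≈ fromℕ (suc k)
  hook≈ {r = r} {c = c} r<a c<b with ℕ.m≤n⇒∃[o]m+o≡n r<a | ℕ.m≤n⇒∃[o]m+o≡n c<b
  ... | x , ≡.refl | y , ≡.refl = x ℕ.+ y , (begin
    fromℕ (suc r ℕ.+ x ℕ.+ (suc c ℕ.+ y)) - fromℕ (suc r) - fromℕ (suc c) + 1#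
      ≈⟨ +-congʳ (+-congʳ (+-congʳ (trans (fromℕ-+ (suc r ℕ.+ x) (suc c ℕ.+ y))
           (+-cong (fromℕ-+ (suc r) x) (fromℕ-+ (suc c) y))))) ⟩
    fromℕ (suc r) + fromℕ x + (fromℕ (suc c) + fromℕ y) - fromℕ (suc r) - fromℕ (suc c) + 1#
      ≈⟨ solve 4 (λ r c x y → r :+ x :+ (c :+ y) :- r :- c :+ con (+ 1) := con (+ 1) :+ (x :+ y)) refl
           (fromℕ (suc r)) (fromℕ (suc c)) (fromℕ x) (fromℕ y) ⟩
    1# + (fromℕ x + fromℕ y)
      ≈⟨ +-congˡ (fromℕ-+ x y) ⟨
    fromℕ (suc (x ℕ.+ y)) ∎)

  ∏-/ : ∀ n f g → (∀ i → i ℕ.< n → ¬ (g i ≈ 0#)) → ∏[ i < n ] (f i / g i) * ∏ n g ≈ ∏ n f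
  ∏-/ n f g g≉0 = trans (sym (∏-* n (λ i → f i / g i) g))
    (∏-cong n (λ i → f i / g i * g i) f λ i i<n → /-* (g≉0 i i<n))

  ∏-nonZero : ∀ n f → (∀ i → ¬ (f i ≈ 0#)) → ¬ (∏ n f ≈ 0#)
  ∏-nonZero zero    f f≉0 = 1≉0
  ∏-nonZero (suc n) f f≉0 = *-nonZero (f≉0 0) (∏-nonZero n (f ∘ suc) (f≉0 ∘ suc))

  ∏-4^ : ∀ n → ∏[ i < n ] (fromℕ 4 ^ i) ≈ fromℕ 2 ^ (n ℕ.* (n ∸ 1))
  ∏-4^ zero          = refl
  ∏-4^ (suc zero)    = *-identityʳ 1#
  ∏-4^ (suc (suc n)) = begin
    ∏[ i < suc (suc n) ] (fromℕ 4 ^ i)                           ≈⟨ ∏-last (suc n) (fromℕ 4 ^_) ⟩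
    ∏[ i < suc n ] (fromℕ 4 ^ i) * fromℕ 4 ^ suc n               ≈⟨ *-cong (∏-4^ (suc n)) (begin
      fromℕ 4 ^ suc n                                               ≈⟨ ^-congˡ (suc n) (fromℕ-* 2 2) ⟩
      (fromℕ 2 * fromℕ 2) ^ suc n
        ≈⟨ ^-distrib-* (fromℕ 2) (fromℕ 2) (suc n) ⟩
      fromℕ 2 ^ suc n * fromℕ 2 ^ suc n                             ≈⟨ ^-homo-* (fromℕ 2) (suc n) (suc n) ⟨
      fromℕ 2 ^ (suc n ℕ.+ suc n)                                   ∎) ⟩
    fromℕ 2 ^ (suc n ℕ.* n) * fromℕ 2 ^ (suc n ℕ.+ suc n)
      ≈⟨ ^-homo-* (fromℕ 2) (suc n ℕ.* n) (suc n ℕ.+ suc n) ⟨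
    fromℕ 2 ^ (suc n ℕ.* n ℕ.+ (suc n ℕ.+ suc n))                ≡⟨ ≡.cong (fromℕ 2 ^_) (nat n) ⟩
    fromℕ 2 ^ (suc (suc n) ℕ.* suc n)                            ∎
    where
    nat : ∀ n → suc n ℕ.* n ℕ.+ (suc n ℕ.+ suc n) ≡ suc (suc n) ℕ.* suc n
    nat = solve-∀

-- The Vandermonde product at the interleaved points.

module InterleavedPoints {c ℓ} (K : Field c ℓ) where
  open Field K hiding (zero)
  open OverField K
  open IntegerCoefficients commutativeRing using (solve; _:=_; _:+_; _:*_; _:-_; :-_; con)
  open SetoidReasoning setoid
  open CommutativeMonoidSums *-commutativeMonoid using () renaming (sum to product; sum-cong-≋ to product-cong)
  open SemiringExp semiring using (^-homo-*; ^-assocʳ)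
  open Determinants K
  open RowOperations K
  open Products K

  parameter : Carrier → Carrier → ℕ → Carrier
  parameter S T zero          = S
  parameter S T (suc zero)    = T
  parameter S T (suc (suc j)) = parameter S T j

  parameter-double : ∀ S T l → parameter S T (double l) ≡ S
  parameter-double S T zero    = ≡.refl
  parameter-double S T (suc l) = parameter-double S T l

  parameter-1+double : ∀ S T l → parameter S T (suc (double l)) ≡ T
  parameter-1+double S T zero    = ≡.refl
  parameter-1+double S T (suc l) = parameter-1+double S T l

  point : Carrier → Carrier → ℕ → Carrier
  point S T j = parameter S T j + fromℕ ⌊ j /2⌋

  point-double : ∀ S T l → point S T (double l) ≡ S + fromℕ l
  point-double S T l = ≡.cong₂ (λ x k → x + fromℕ k) (parameter-double S T l) (⌊double/2⌋ l)

  point-1+double : ∀ S T l → point S T (suc (double l)) ≡ T + fromℕ l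
  point-1+double S T l = ≡.cong₂ (λ x k → x + fromℕ k) (parameter-1+double S T l) (⌊1+double/2⌋ l)

  -- Dropping the first point leaves a sequence of the same kind with the roles exchanged. This
  -- allows an induction on the number of points without separating parities.
  point-suc : ∀ S T j → point S T (suc j) ≈ point T (S + 1#) j
  point-suc S T zero          = refl
  point-suc S T (suc zero)    = solve 1 (λ s → s :+ (con (+ 1) :+ con (+ 0))
      := s :+ con (+ 1) :+ con (+ 0)) refl S
  point-suc S T (suc (suc j)) = begin
    parameter S T (suc j) + (1# + fromℕ ⌊ suc j /2⌋)
      ≈⟨ solve 2 (λ x y → x :+ (con (+ 1) :+ y) := con (+ 1) :+ (x :+ y)) refl _ _ ⟩
    1# + point S T (suc j)                                   ≈⟨ +-congˡ (point-suc S T j) ⟩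
    1# + point T (S + 1#) j
      ≈⟨ solve 2 (λ x y → x :+ (con (+ 1) :+ y) := con (+ 1) :+ (x :+ y)) refl _ _ ⟨
    parameter T (S + 1#) j + (1# + fromℕ ⌊ j /2⌋)            ∎

  differences-cong : ∀ {n} {x y : Fin n → Carrier} → x ≐ y → differences x ≈ differences y
  differences-cong {zero}  e = refl
  differences-cong {suc n} {x} {y} e = *-cong
    (product-cong {x = λ j → x zero - x (suc j)} {λ j → y zero - y (suc j)} λ j →
        +-cong (e zero) (-‿cong (e (suc j))))
    (differences-cong (e ∘ suc))

  cross : ℕ → ℕ → Carrier → Carrier → Carrier
  cross a b S T = ∏[ r < a ] ∏[ c < b ] ((T + fromℕ c) - (S + fromℕ r))

  ∏-neg-id : ∀ n → ∏[ i < n ] (- fromℕ (suc i)) ≈ (- 1#) ^ n * fromℕ (n !)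
  ∏-neg-id n = trans (∏-neg n (λ i → fromℕ (suc i))) (*-congˡ (∏-suc n))
    where
    ∏-suc : ∀ n → ∏[ i < n ] (fromℕ (suc i)) ≈ fromℕ (n !)
    ∏-suc zero    = sym (+-identityʳ 1#)
    ∏-suc (suc n) = trans (∏-last n (λ i → fromℕ (suc i)))
      (trans (*-congʳ (∏-suc n)) (trans (*-comm _ _) (sym (fromℕ-* (suc n) (n !)))))

  -- Every one of the a·b factors changes sign and the rectangle is transposed. The shift S+1
  -- becomes `suc r`, leaving free the row r = 0 that the removed first point supplies.
  cross-swap : ∀ a b S T →
    cross a b T (S + 1#) ≈ (- 1#) ^ (a ℕ.* b) * ∏[ r < b ] ∏[ c < a ] ((T + fromℕ c) - (S + fromℕ (suc r)))
  cross-swap a b S T = begin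
    ∏[ r < a ] ∏[ c < b ] (S + 1# + fromℕ c - (T + fromℕ r))
      ≈⟨ ∏-cong a (λ r → ∏[ c < b ] (S + 1# + fromℕ c - (T + fromℕ r))) (λ r →
          (- 1#) ^ b * ∏[ c < b ] g c r) (λ r _ → trans
           (∏-cong b (λ c → S + 1# + fromℕ c - (T + fromℕ r)) (λ c → - g c r) λ c _ →
             solve 4 (λ s t c r → s :+ con (+ 1) :+ c :- (t :+ r)
                 := :- (t :+ r :- (s :+ (con (+ 1) :+ c)))) refl S T (fromℕ c) (fromℕ r))
           (∏-neg b (λ c → g c r))) ⟩
    ∏[ r < a ] ((- 1#) ^ b * ∏[ c < b ] g c r)
      ≈⟨ ∏-* a (λ _ → (- 1#) ^ b) (λ r → ∏[ c < b ] g c r) ⟩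
    ∏[ r < a ] ((- 1#) ^ b) * ∏[ r < a ] ∏[ c < b ] g c r
      ≈⟨ *-cong (trans (∏-const a ((- 1#) ^ b)) (trans (^-assocʳ (- 1#) b a) (reflexive
          (≡.cong ((- 1#) ^_) (ℕ.*-comm b a)))))
           (∏-comm a b (λ r c → g c r)) ⟩
    (- 1#) ^ (a ℕ.* b) * ∏[ r < b ] ∏[ c < a ] g r c ∎
    where
    g : ℕ → ℕ → Carrier
    g r c = (T + fromℕ c) - (S + fromℕ (suc r))

  -- The row signs (-1)ⁱ are evaluated together with the differences because they nearly cancel.
  -- With p = ⌈n/2⌉ and q = ⌊n/2⌋, a new first point S contributes (-1)ᵖ against the T-points and
  -- (-1)^q q! against the S-points, while the row signs gain (-1)ⁿ; as p+q = n, only the sign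
  -- (-1)^(pq) of `cross-swap` is left, which is the increment of `sgn`.
  differences-point : ∀ n S T →
    ∏[ i < n ] ((- 1#) ^ i) * differences {n} (point S T ∘ toℕ)
      ≈ sgn n * (superfactorial ⌈ n /2⌉ * superfactorial ⌊ n /2⌋ * cross ⌈ n /2⌉ ⌊ n /2⌋ S T)
  differences-point zero    S T = solve 0 (con (+ 1) :* con (+ 1)
      := con (+ 1) :* (con (+ 1) :* con (+ 1) :* con (+ 1))) refl
  differences-point (suc n) S T = begin
    ∏[ i < suc n ] ((- 1#) ^ i) * (∏[ j < n ] (point S T 0 - point S T (suc j)) * differences {n} (point S T ∘ suc ∘ toℕ))
      ≈⟨ *-cong (∏-last n ((- 1#) ^_)) (*-cong first (differences-cong {n} λ i → point-suc S T (toℕ i))) ⟩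
    E * ε n * (ε p * Z₀ * (ε q * fromℕ (q !)) * V)
      ≈⟨ solve 7 (λ e x y z u w v → e :* x :* (y :* z :* (u :* w) :* v)
          := x :* y :* u :* z :* w :* (e :* v)) refl
           E (ε n) (ε p) Z₀ (ε q) (fromℕ (q !)) V ⟩
    ε n * ε p * ε q * Z₀ * fromℕ (q !) * (E * V)
      -- The T-block is now the leading one, with p points; the remaining S-block has q points and
      -- regains its first one through q!.
      ≈⟨ *-congˡ (trans (differences-point n T (S + 1#)) (*-congˡ (*-congˡ (cross-swap p q S T)))) ⟩
    ε n * ε p * ε q * Z₀ * fromℕ (q !) * (sgn n * (superfactorial p * superfactorial q * (ε (p ℕ.* q) * Z₁)))
      ≈⟨ *-congʳ (*-congʳ (*-congʳ signs)) ⟩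
    1# * Z₀ * fromℕ (q !) * (sgn n * (superfactorial p * superfactorial q * (ε (p ℕ.* q) * Z₁)))
      ≈⟨ solve 7 (λ z f g u v e w → con (+ 1) :* z :* f :* (g :* (u :* v :* (e :* w)))
          := g :* e :* (v :* f :* u :* (z :* w))) refl
           Z₀ (fromℕ (q !)) (sgn n) (superfactorial p) (superfactorial q) (ε (p ℕ.* q)) Z₁ ⟩
    sgn n * ε (p ℕ.* q) * (superfactorial q * fromℕ (q !) * superfactorial p * (Z₀ * Z₁))
      ≈⟨ *-cong (sgn-suc n) (*-congʳ (*-congʳ (∏-last q (λ i → fromℕ (i !))))) ⟨
    sgn (suc n) * (superfactorial (suc q) * superfactorial p * cross (suc q) p S T) ∎
    where
    ε : ℕ → Carrier
    ε k = (- 1#) ^ k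
    p q : ℕ
    p = ⌈ n /2⌉
    q = ⌊ n /2⌋
    E V Z₀ Z₁ : Carrier
    E = ∏[ i < n ] ((- 1#) ^ i)
    V = differences {n} (point T (S + 1#) ∘ toℕ)
    Z₀ = ∏[ c < p ] ((T + fromℕ c) - (S + 0#))
    Z₁ = ∏[ r < q ] ∏[ c < p ] ((T + fromℕ c) - (S + fromℕ (suc r)))

    first : ∏[ j < n ] (point S T 0 - point S T (suc j)) ≈ ε p * Z₀ * (ε q * fromℕ (q !))
    first = begin
      ∏[ j < n ] (point S T 0 - point S T (suc j))
        ≈⟨ ∏-interleave n (λ j → point S T 0 - point S T (suc j)) ⟩
      ∏[ l < p ] (S + 0# - point S T (suc (double l))) * ∏[ l < q ] (S + 0# - point S T (double (suc l)))
        ≈⟨ *-cong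
             (trans (∏-cong p (λ l → S + 0# - point S T (suc (double l))) (λ l →
                 - ((T + fromℕ l) - (S + 0#))) λ l _ →
                trans (+-congˡ (-‿cong (reflexive (point-1+double S T l))))
                  (solve 2 (λ x y → x :- y := :- (y :- x)) refl (S + 0#) (T + fromℕ l)))
              (∏-neg p (λ l → (T + fromℕ l) - (S + 0#))))
             (trans (∏-cong q (λ l → S + 0# - point S T (double (suc l))) (λ l → - fromℕ (suc l)) λ l _ →
                trans (+-congˡ (-‿cong (reflexive (point-double S T (suc l)))))
                  (solve 2 (λ x y → x :+ con (+ 0) :- (x :+ y) := :- y) refl S (fromℕ (suc l))))
              (∏-neg-id q)) ⟩
      ε p * Z₀ * (ε q * fromℕ (q !)) ∎

    signs : ε n * ε p * ε q ≈ 1#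
    signs = begin
      ε n * ε p * ε q       ≈⟨ *-assoc _ _ _ ⟩
      ε n * (ε p * ε q)     ≈⟨ *-congˡ (^-homo-* (- 1#) p q) ⟨
      ε n * ε (p ℕ.+ q)     ≡⟨ ≡.cong (λ k → ε n * ε k) (≡.trans (ℕ.+-comm p q) (ℕ.⌊n/2⌋+⌈n/2⌉≡n n)) ⟩
      ε n * ε n             ≈⟨ sign² n ⟩
      1#                    ∎

-- Bessel coefficients, their moments, and the determinant over a field of characteristic 0.

module BesselDeterminant {c ℓ} (K : Field c ℓ) where
  open Field K hiding (zero)
  open OverField K
  open IntegerCoefficients commutativeRing using (solve; _:=_; _:+_; _:*_; _:-_; :-_; con)
  open SetoidReasoning setoid
  open CommutativeMonoidSums *-commutativeMonoid using () renaming (sum to product)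
  open FieldProperties K
  open Determinants K
  open RowOperations K
  open Products K
  open InterleavedPoints K

  evenSeries-double : ∀ u k → evenSeries u (double k) ≡ u k
  evenSeries-double u zero    = ≡.refl
  evenSeries-double u (suc k) = evenSeries-double (u ∘ suc) k

  evenSeries-1+double : ∀ u k → evenSeries u (suc (double k)) ≡ 0#
  evenSeries-1+double u zero    = ≡.refl
  evenSeries-1+double u (suc k) = evenSeries-1+double (u ∘ suc) k

  fromℕ-double : ∀ k → fromℕ (double k) ≈ fromℕ 2 * fromℕ k
  fromℕ-double k = trans (reflexive (≡.cong fromℕ (≡.sym (2*≡double k)))) (fromℕ-* 2 k)

  pochhammer-suc : ∀ γ m → pochhammer γ (suc m) ≈ pochhammer γ m * (γ + fromℕ m)
  pochhammer-suc γ m = ∏-last m (λ i → γ + fromℕ i)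

  -- The last m factors of (σ+1)_{N+p}, read downwards, are x+N, x+N-1, ... at x = σ+p. The shifts
  -- N-k do not depend on the column, as `det-Π` requires.
  pochhammer-Π : ∀ N σ p m → m ℕ.≤ N →
    pochhammer (σ + 1#) (N ℕ.+ p) ≈
    pochhammer (σ + 1#) (N ∸ m ℕ.+ p) * Π (λ k → fromℕ (N ∸ k)) m (σ + fromℕ p)
  pochhammer-Π N σ p zero    m≤N = sym (*-identityʳ _)
  pochhammer-Π N σ p (suc m) m<N = begin
    pochhammer (σ + 1#) (N ℕ.+ p)
      ≈⟨ pochhammer-Π N σ p m (ℕ.<⇒≤ m<N) ⟩
    pochhammer (σ + 1#) (N ∸ m ℕ.+ p) * Q
      ≡⟨ ≡.cong (λ k → pochhammer (σ + 1#) (k ℕ.+ p) * Q) N∸m ⟩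
    pochhammer (σ + 1#) (suc (r ℕ.+ p)) * Q
      ≈⟨ *-congʳ (trans (pochhammer-suc (σ + 1#) (r ℕ.+ p)) (*-congˡ (+-congˡ (fromℕ-+ r p)))) ⟩
    pochhammer (σ + 1#) (r ℕ.+ p) * (σ + 1# + (fromℕ r + fromℕ p)) * Q
      ≈⟨ solve 5 (λ P σ r p Q → P :* (σ :+ con (+ 1) :+ (r :+ p)) :* Q
          := P :* ((σ :+ p :+ (con (+ 1) :+ r)) :* Q)) refl
           (pochhammer (σ + 1#) (r ℕ.+ p)) σ (fromℕ r) (fromℕ p) Q ⟩
    pochhammer (σ + 1#) (r ℕ.+ p) * ((σ + fromℕ p + fromℕ (suc r)) * Q)
      ≡⟨ ≡.cong (λ k → pochhammer (σ + 1#) (r ℕ.+ p) * ((σ + fromℕ p + fromℕ k) * Q)) N∸m ⟨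
    pochhammer (σ + 1#) (r ℕ.+ p) * ((σ + fromℕ p + fromℕ (N ∸ m)) * Q) ∎
    where
    r : ℕ
    r = N ∸ suc m
    Q : Carrier
    Q = Π (λ k → fromℕ (N ∸ k)) m (σ + fromℕ p)
    N∸m : N ∸ m ≡ suc r
    N∸m = ℕ.+-∸-assoc 1 m<N

  module _ (characteristic-0 : ∀ k → ¬ (fromℕ (suc k) ≈ 0#)) where

    2≉0 : ¬ (1# + 1# ≈ 0#)
    2≉0 e = characteristic-0 1 (trans (+-congˡ (+-identityʳ 1#)) e)

    2*½≈1 : fromℕ 2 * ½ ≈ 1#
    2*½≈1 = trans (*-congˡ (*-identityˡ _)) (*-inverseʳ (characteristic-0 1))

    ½+½≈1 : ½ + ½ ≈ 1#
    -- The numeral is spelt out because `fromℕ 2` unfolds to `1# + (1# + 0#)`.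
    ½+½≈1 = trans (solve 1 (λ h → h :+ h := (con (+ 1) :+ (con (+ 1) :+ con (+ 0))) :* h) refl ½) 2*½≈1

    -- From (2k+2)(2k+1) = 4(k+1)(k+½). It cancels the 4ᵏ k! in the Bessel coefficients and later
    -- assembles the product of the (2i)!.
    [2k]! : ∀ k → fromℕ (double k !) ≈ fromℕ 4 ^ k * fromℕ (k !) * pochhammer ½ k
    [2k]! zero    = solve 0 (con (+ 1) :+ con (+ 0)
        := con (+ 1) :* (con (+ 1) :+ con (+ 0)) :* con (+ 1)) refl
    [2k]! (suc k) = begin
      fromℕ (suc (suc (double k)) ℕ.* (suc (double k) ℕ.* double k !))
        ≈⟨ trans (fromℕ-* (suc (suc (double k))) (suc (double k) ℕ.* double k !))
             (*-cong (+-congˡ (+-congˡ (fromℕ-double k)))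
               (trans (fromℕ-* (suc (double k)) (double k !)) (*-cong (+-cong
                   (sym 2*½≈1) (fromℕ-double k)) ([2k]! k)))) ⟩
      (1# + (1# + fromℕ 2 * fromℕ k)) * ((fromℕ 2 * ½ + fromℕ 2 * fromℕ k) * (fromℕ 4 ^ k * fromℕ (k !) * pochhammer ½ k))
        ≈⟨ solve 5 (λ k h e f p → let two = con (+ 1) :+ (con (+ 1) :+ con (+ 0)) in
             (con (+ 1) :+ (con (+ 1) :+ two :* k)) :* ((two :* h :+ two :* k) :* (e :* f :* p))
             := (con (+ 1) :+ (con (+ 1) :+ two)) :* e :* ((con (+ 1) :+ k) :* f) :* (p :* (h :+ k))) refl
             (fromℕ k) ½ (fromℕ 4 ^ k) (fromℕ (k !)) (pochhammer ½ k) ⟩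
      fromℕ 4 ^ suc k * (fromℕ (suc k) * fromℕ (k !)) * (pochhammer ½ k * (½ + fromℕ k))
        ≈⟨ *-cong (*-congˡ (fromℕ-* (suc k) (k !))) (pochhammer-suc ½ k) ⟨
      fromℕ 4 ^ suc k * fromℕ (suc k !) * pochhammer ½ (suc k) ∎

    !≉0 : ∀ k → ¬ (fromℕ (k !) ≈ 0#)
    !≉0 zero    = characteristic-0 0
    !≉0 (suc k) e = *-nonZero (characteristic-0 k) (!≉0 k) (trans (sym (fromℕ-* (suc k) (k !))) e)

    4^≉0 : ∀ k → ¬ (fromℕ 4 ^ k ≈ 0#)
    4^≉0 zero    = 1≉0
    4^≉0 (suc k) = *-nonZero (characteristic-0 3) (4^≉0 k)

    -- No factor of any (σ+1)ₘ vanishes, so the total inverse is never taken at 0 in these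
    -- denominators.
    Regular : Carrier → Set ℓ
    Regular σ = ∀ k → ¬ (σ + 1# + fromℕ k ≈ 0#)

    pochhammer≉0 : ∀ {σ} → Regular σ → ∀ m → ¬ (pochhammer (σ + 1#) m ≈ 0#)
    pochhammer≉0 {σ} σ-reg m = ∏-nonZero m (λ i → σ + 1# + fromℕ i) σ-reg

    cosb-double : ∀ {σ} → Regular σ → ∀ k →
      fromℕ (double k !) * cosb σ (double k) * pochhammer (σ + 1#) k ≈ (- 1#) ^ k * pochhammer ½ k
    cosb-double {σ} σ-reg k = begin
      fromℕ (double k !) * cosb σ (double k) * P
        ≈⟨ *-congʳ (*-cong ([2k]! k) (reflexive (evenSeries-double _ k))) ⟩
      F * G * H * ((- 1#) ^ k / (F * G * P)) * P
        ≈⟨ solve 5 (λ f g h e p → f :* g :* h :* e :* p := e :* (f :* g :* p) :* h)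
            refl F G H ((- 1#) ^ k / (F * G * P)) P ⟩
      (- 1#) ^ k / (F * G * P) * (F * G * P) * H
        ≈⟨ *-congʳ (/-* (*-nonZero (*-nonZero (4^≉0 k) (!≉0 k)) (pochhammer≉0 σ-reg k))) ⟩
      (- 1#) ^ k * H ∎
      where
      F G H P : Carrier
      F = fromℕ 4 ^ k
      G = fromℕ (k !)
      H = pochhammer ½ k
      P = pochhammer (σ + 1#) k

    a-even : ∀ σ τ k → a σ τ (double k) ≈ fromℕ (double k !) * cosb σ (double k)
    a-even σ τ k = *-congˡ (trans (+-congˡ (integral k)) (+-identityʳ _))
      where
      integral : ∀ k → ∫₀ˣ (cosb τ) (double k) ≈ 0#
      integral zero    = refl
      integral (suc k) = trans (*-congʳ (reflexive (evenSeries-1+double _ k))) (zeroˡ _)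

    -- The divisor 2k+1 introduced by integration cancels against (2k+1)!, so odd coefficients have
    -- the form of even ones.
    a-odd : ∀ σ τ k → a σ τ (suc (double k)) ≈ fromℕ (double k !) * cosb τ (double k)
    a-odd σ τ k = begin
      fromℕ (suc (double k) !) * (cosb σ (suc (double k)) + U / D)
        ≈⟨ *-cong (fromℕ-* (suc (double k)) (double k !)) (+-congʳ (reflexive (evenSeries-1+double _ k))) ⟩
      D * fromℕ (double k !) * (0# + U / D)
        ≈⟨ solve 3 (λ d f q → d :* f :* (con (+ 0) :+ q) := f :* (q :* d))
            refl D (fromℕ (double k !)) (U / D) ⟩
      fromℕ (double k !) * (U / D * D)
        ≈⟨ *-congˡ (/-* (characteristic-0 (double k))) ⟩
      fromℕ (double k !) * U ∎
      where
      U D : Carrier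
      U = cosb τ (double k)
      D = fromℕ (suc (double k))

    module _ (S T : Carrier) (S-reg : Regular S) (T-reg : Regular T) where

      parameter-regular : ∀ j → Regular (parameter S T j)
      parameter-regular zero          = S-reg
      parameter-regular (suc zero)    = T-reg
      parameter-regular (suc (suc j)) = parameter-regular j

      -- An infinite sequence rather than a matrix column: multiplying by 1+y reads row i+1, which
      -- may lie below the matrix.
      column : ℕ → ℕ → Carrier
      column j i = a S T (2 ℕ.* i ℕ.+ j)

      -- The Hankel structure of each block: multiplication by y, a shift of the rows, leads to the
      -- next column of the same block.
      column-shift : ∀ j i → column (suc (suc j)) i ≡ column j (suc i)
      column-shift j i = ≡.cong (a S T) (nat i j)
        where
        nat : ∀ i j → 2 ℕ.* i ℕ.+ suc (suc j) ≡ 2 ℕ.* suc i ℕ.+ j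
        nat = solve-∀

      -- If μ is the functional with μ(yⁱ) = a₂ᵢ (or a₂ᵢ₊₁), this is μ(yⁱ(1+y)ᵖ) with p = ⌊ j /2⌋.
      moment : ℕ → ℕ → Carrier
      moment zero          i = column 0 i
      moment (suc zero)    i = column 1 i
      moment (suc (suc j)) i = moment j i + moment j (suc i)

      -- Multiplying by 1+y keeps the old columns and adds a copy moved two places to the right, so
      -- the leading one becomes `column (suc (suc j))` with coefficient 1.
      moment-column : ∀ j → ∃ λ w → Span (ℕ._< j) column w × (∀ i → moment j i ≈ column j i + w i)
      moment-column zero          = (λ _ → 0#) , none (λ _ → refl) , λ i → sym (+-identityʳ _)
      moment-column (suc zero)    = (λ _ → 0#) , none (λ _ → refl) , λ i → sym (+-identityʳ _)
      moment-column (suc (suc j)) with moment-column j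
      ... | w , σ , e = w′ , σ′ , λ i → begin
          moment j i + moment j (suc i)
            ≈⟨ +-cong (e i) (e (suc i)) ⟩
          column j i + w i + (column j (suc i) + w (suc i))
            ≡⟨ ≡.cong (λ x → column j i + w i + (x + w (suc i))) (column-shift j i) ⟨
          column j i + w i + (column (suc (suc j)) i + w (suc i))
            ≈⟨ solve 4 (λ x y z u → x :+ y :+ (z :+ u)
                := z :+ (con (+ 1) :* x :+ (con (+ 1) :* y :+ con (+ 1) :* u))) refl
                 (column j i) (w i) (column (suc (suc j)) i) (w (suc i)) ⟩
          column (suc (suc j)) i + w′ i ∎
        where
        w′ : ℕ → Carrier
        w′ i = 1# * column j i + (1# * w i + 1# * w (suc i))
        σ′ : Span (ℕ._< suc (suc j)) column w′
        σ′ = span-+ (span-generator 1# j (ℕ.m<n⇒m<1+n (ℕ.n<1+n j))) (span-+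
          (span-map (λ _ → 1#) id (λ k k<j → span-generator 1# k (ℕ.m<n⇒m<1+n (ℕ.m<n⇒m<1+n k<j))) σ)
          (span-map (λ _ → 1#) suc (λ k k<j → span-resp (λ i → *-congˡ (reflexive (column-shift k i)))
             (span-generator 1# (suc (suc k)) (ℕ.s≤s (ℕ.s≤s k<j)))) σ))

      rowFactor : ℕ → Carrier
      rowFactor i = (- 1#) ^ i * pochhammer ½ i

      -- The Beta value with its denominator cleared. The induction steps by two in `j`, staying
      -- within one block, and uses the hypothesis at rows `i` and `suc i`.
      moment-value : ∀ j i → let σ = parameter S T j; p = ⌊ j /2⌋ in
        moment j i * pochhammer (σ + 1#) (i ℕ.+ p) ≈ rowFactor i * pochhammer (σ + ½) p
      moment-value zero i = begin
        a S T (2 ℕ.* i ℕ.+ 0) * pochhammer (S + 1#) (i ℕ.+ 0)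
          ≡⟨ ≡.cong₂ (λ x y → a S T x * pochhammer (S + 1#) y)
              (≡.trans (ℕ.+-identityʳ _) (2*≡double i)) (ℕ.+-identityʳ i) ⟩
        a S T (double i) * pochhammer (S + 1#) i
          ≈⟨ trans (*-congʳ (a-even S T i)) (cosb-double S-reg i) ⟩
        rowFactor i
          ≈⟨ *-identityʳ _ ⟨
        rowFactor i * 1# ∎
      moment-value (suc zero) i = begin
        a S T (2 ℕ.* i ℕ.+ 1) * pochhammer (T + 1#) (i ℕ.+ 0)
          ≡⟨ ≡.cong₂ (λ x y → a S T x * pochhammer (T + 1#) y)
               (≡.trans (ℕ.+-comm _ 1) (≡.cong suc (2*≡double i))) (ℕ.+-identityʳ i) ⟩
        a S T (suc (double i)) * pochhammer (T + 1#) i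
          ≈⟨ trans (*-congʳ (a-odd S T i)) (cosb-double T-reg i) ⟩
        rowFactor i
          ≈⟨ *-identityʳ _ ⟨
        rowFactor i * 1# ∎
      moment-value (suc (suc j)) i = begin
        (M + M′) * pochhammer (σ + 1#) (i ℕ.+ suc p)
          ≡⟨ ≡.cong (λ k → (M + M′) * pochhammer (σ + 1#) k) (ℕ.+-suc i p) ⟩
        (M + M′) * pochhammer (σ + 1#) (suc (i ℕ.+ p))
          ≈⟨ distribʳ _ M M′ ⟩
        M * pochhammer (σ + 1#) (suc (i ℕ.+ p)) + M′ * pochhammer (σ + 1#) (suc i ℕ.+ p)
          ≈⟨ +-cong (trans (*-congˡ (trans (pochhammer-suc (σ + 1#) (i ℕ.+ p)) (*-congˡ
              (+-congˡ (fromℕ-+ i p)))))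
                           (sym (*-assoc _ _ _)))
                    (trans (moment-value j (suc i)) (*-congʳ (*-congˡ (pochhammer-suc ½ i)))) ⟩
        M * pochhammer (σ + 1#) (i ℕ.+ p) * (σ + 1# + (fromℕ i + fromℕ p))
            + (- 1#) ^ suc i * (H * (½ + fromℕ i)) * Q
          -- Writing 1 as ½+½ makes the remaining identity polynomial in an indeterminate ½.
          ≈⟨ +-congʳ (*-cong (moment-value j i) (+-congʳ (+-congˡ (sym ½+½≈1)))) ⟩
        (- 1#) ^ i * H * Q * (σ + (½ + ½) + (fromℕ i + fromℕ p)) + (- 1#) ^ suc i * (H * (½ + fromℕ i)) * Q
          ≈⟨ solve 7 (λ e H Q σ h i p →
              e :* H :* Q :* (σ :+ (h :+ h) :+ (i :+ p)) :+ (:- con (+ 1) :* e) :* (H :* (h :+ i)) :* Q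
                                     := e :* H :* (Q :* (σ :+ h :+ p))) refl
               ((- 1#) ^ i) H Q σ ½ (fromℕ i) (fromℕ p) ⟩
        rowFactor i * (Q * (σ + ½ + fromℕ p))
          ≈⟨ *-congˡ (pochhammer-suc (σ + ½) p) ⟨
        rowFactor i * pochhammer (σ + ½) (suc p) ∎
        where
        p : ℕ
        p = ⌊ j /2⌋
        σ M M′ H Q : Carrier
        σ = parameter S T j
        M = moment j i
        M′ = moment j (suc i)
        H = pochhammer ½ i
        Q = pochhammer (σ + ½) p

      columnFactor : ℕ → ℕ → Carrier
      columnFactor N j = pochhammer (parameter S T j + ½) ⌊ j /2⌋ / pochhammer (parameter S T j + 1#) (N ℕ.+ ⌊ j /2⌋)

      -- Enlarging the denominator to (σ+1)_{N+p} makes it the same for all rows; the excess factors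
      -- form a polynomial of degree N-i in the point.
      moment-factorised : ∀ N j i → i ℕ.≤ N →
        moment j i ≈ columnFactor N j * (rowFactor i * Π (λ k → fromℕ (N ∸ k)) (N ∸ i) (point S T j))
      moment-factorised N j i i≤N = trans
        (*≈⇒≈/ (pochhammer≉0 (parameter-regular j) (N ℕ.+ p)) (begin
          moment j i * pochhammer (σ + 1#) (N ℕ.+ p)
            ≈⟨ *-congˡ (pochhammer-Π N σ p (N ∸ i) (ℕ.m∸n≤m N i)) ⟩
          moment j i * (pochhammer (σ + 1#) (N ∸ (N ∸ i) ℕ.+ p) * R)
            ≡⟨ ≡.cong (λ k → moment j i * (pochhammer (σ + 1#) (k ℕ.+ p) * R)) (ℕ.m∸[m∸n]≡n i≤N) ⟩
          moment j i * (pochhammer (σ + 1#) (i ℕ.+ p) * R)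
            ≈⟨ trans (sym (*-assoc _ _ _)) (*-congʳ (moment-value j i)) ⟩
          rowFactor i * pochhammer (σ + ½) p * R ∎))
        (solve 4 (λ x y z u → x :* y :* z :* u := y :* u :* (x :* z)) refl
          (rowFactor i) (pochhammer (σ + ½) p) R (pochhammer (σ + 1#) (N ℕ.+ p) ⁻¹))
        where
        p : ℕ
        p = ⌊ j /2⌋
        σ R : Carrier
        σ = parameter S T j
        R = Π (λ k → fromℕ (N ∸ k)) (N ∸ i) (point S T j)

      det-column : ∀ N → let n = suc N in
        det {n} (λ i j → column (toℕ j) (toℕ i))
          ≈ ∏ n (columnFactor N) * (∏ n rowFactor * differences {n} (point S T ∘ toℕ))
      det-column N = begin
        -- `A` has the sequences `column j` as rows, since the unitriangular replacement is
        -- available for rows.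
        det (A ᵀ)
          ≈⟨ det-ᵀ (A ᵀ) ⟩
        det A
          ≈⟨ det-unitriangular 2≉0 A B unitriangular ⟨
        det B
          ≈⟨ det-cong {A = B} {λ j i → κ j * (ρ i * P i j)} (λ j i →
              moment-factorised N (toℕ j) (toℕ i) (ℕ.<⇒≤pred (Fin.toℕ<n i))) ⟩
        det (λ j i → κ j * (ρ i * P i j))
          ≈⟨ det-scaleRows κ (λ j i → ρ i * P i j) ⟩
        product κ * det (λ j i → ρ i * P i j)
          ≈⟨ *-congˡ (det-scaleColumns ρ (P ᵀ)) ⟩
        product κ * (product ρ * det (P ᵀ))
          ≈⟨ *-congˡ (*-congˡ (trans (sym (det-ᵀ P)) (det-Π 2≉0 n (λ k → fromℕ (N ∸ k)) (point S T ∘ toℕ)))) ⟩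
        product κ * (product ρ * differences {n} (point S T ∘ toℕ)) ∎
        where
        n : ℕ
        n = suc N
        A B P : Matrix n
        A j i = column (toℕ j) (toℕ i)
        B j i = moment (toℕ j) (toℕ i)
        P i j = Π (λ k → fromℕ (N ∸ k)) (N ∸ toℕ i) (point S T (toℕ j))
        κ ρ : Fin n → Carrier
        κ j = columnFactor N (toℕ j)
        ρ i = rowFactor (toℕ i)
        unitriangular : ∀ j → ∃ λ w → Span (λ k → toℕ k ℕ.< toℕ j) A w × (∀ i → B j i ≈ A j i + w i)
        unitriangular j with moment-column (toℕ j)
        ... | w , σ , e = (λ i → 1# * w (toℕ i)) , span-map (λ _ → 1#) toℕ generator σ ,
                          λ i → trans (e (toℕ i)) (+-congˡ (sym (*-identityˡ _)))
          where
          generator : ∀ k → k ℕ.< toℕ j → Span (λ k → toℕ k ℕ.< toℕ j) A (λ i → 1# * column k (toℕ i))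
          generator k k<j = span-resp (λ i → *-congˡ (reflexive (≡.cong (λ k → column k (toℕ i)) k′≡k)))
            (span-generator 1# k′ (≡.subst (ℕ._< toℕ j) (≡.sym k′≡k) k<j))
            where
            k<n : k ℕ.< n
            k<n = ℕ.<-trans k<j (Fin.toℕ<n j)
            k′ : Fin n
            k′ = fromℕ< k<n
            k′≡k : toℕ k′ ≡ k
            k′≡k = Fin.toℕ-fromℕ< k<n

      ∏-columnFactor : ∀ N n → ∏ n (columnFactor N) ≈
        ∏[ l < ⌈ n /2⌉ ] (pochhammer (S + ½) l / pochhammer (S + 1#) (N ℕ.+ l))
        * ∏[ m < ⌊ n /2⌋ ] (pochhammer (T + ½) m / pochhammer (T + 1#) (N ℕ.+ m))
      ∏-columnFactor N n = trans (∏-interleave n (columnFactor N)) (*-cong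
        (∏-cong ⌈ n /2⌉ (columnFactor N ∘ double) (factor S) λ l _ →
          reflexive (≡.cong₂ (λ σ p → pochhammer (σ + ½) p / pochhammer (σ + 1#) (N ℕ.+ p))
            (parameter-double S T l) (⌊double/2⌋ l)))
        (∏-cong ⌊ n /2⌋ (columnFactor N ∘ suc ∘ double) (factor T) λ m _ →
          reflexive (≡.cong₂ (λ σ p → pochhammer (σ + ½) p / pochhammer (σ + 1#) (N ℕ.+ p))
            (parameter-1+double S T m) (⌊1+double/2⌋ m))))
        where
        factor : Carrier → ℕ → Carrier
        factor σ l = pochhammer (σ + ½) l / pochhammer (σ + 1#) (N ℕ.+ l)

      -- The (½)ᵢ come from the row factors and the i! from the Vandermonde product; only the 4ⁱ of
      -- (2i)! are missing, hence the power of 2 below.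
      ∏-[2i]! : ∀ n → superfactorial n * ∏ n (pochhammer ½)
        ≈ ∏[ i < n ] fromℕ ((2 ℕ.* i) !) / fromℕ 2 ^ (n ℕ.* (n ∸ 1))
      ∏-[2i]! n = *≈⇒≈/ (2^≉0 (n ℕ.* (n ∸ 1))) (begin
        superfactorial n * ∏ n (pochhammer ½) * fromℕ 2 ^ (n ℕ.* (n ∸ 1))
          ≈⟨ *-congˡ (∏-4^ n) ⟨
        superfactorial n * ∏ n (pochhammer ½) * ∏ n (fromℕ 4 ^_)
          ≈⟨ solve 3 (λ x y z → x :* y :* z := z :* x :* y) refl _ _ _ ⟩
        ∏ n (fromℕ 4 ^_) * superfactorial n * ∏ n (pochhammer ½)
          ≈⟨ trans (∏-* n (λ i → fromℕ 4 ^ i * fromℕ (i !)) (pochhammer ½)) (*-congʳ (∏-* n (fromℕ 4 ^_)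
              (λ i → fromℕ (i !)))) ⟨
        ∏[ i < n ] (fromℕ 4 ^ i * fromℕ (i !) * pochhammer ½ i)
          ≈⟨ ∏-cong n (λ i → fromℕ ((2 ℕ.* i) !)) (λ i → fromℕ 4 ^ i * fromℕ (i !) * pochhammer ½ i) (λ i _ →
               trans (reflexive (≡.cong (λ k → fromℕ (k !)) (2*≡double i))) ([2k]! i)) ⟨
        ∏[ i < n ] fromℕ ((2 ℕ.* i) !) ∎)
        where
        2^≉0 : ∀ k → ¬ (fromℕ 2 ^ k ≈ 0#)
        2^≉0 zero    = 1≉0
        2^≉0 (suc k) = *-nonZero (characteristic-0 1) (2^≉0 k)

      quotients : ℕ → Carrier
      quotients n = ∏[1≤ r ≤ ⌈ n /2⌉ ] ∏[1≤ c ≤ ⌊ n /2⌋ ]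
        ((T - S + fromℕ c - fromℕ r) / (fromℕ n - fromℕ r - fromℕ c + 1#))

      -- Dividing each cross difference by its hook length completes the factorials of the two
      -- blocks to `superfactorial n`. Counting r and c from 1 does not change c-r.
      quotients-cross : ∀ n → superfactorial ⌈ n /2⌉ * superfactorial ⌊ n /2⌋ * cross ⌈ n /2⌉ ⌊ n /2⌋ S T
        ≈ superfactorial n * quotients n
      quotients-cross n = begin
        superfactorial p * superfactorial q * cross p q S T
          ≈⟨ *-congˡ quotients*hooks ⟨
        superfactorial p * superfactorial q * (quotients n * hooks)
          ≈⟨ solve 4 (λ x y z u → x :* y :* (z :* u) := x :* y :* u :* z) refl _ _ _ _ ⟩
        superfactorial p * superfactorial q * hooks * quotients n
          ≈⟨ *-congʳ (superfactorial-+ p q) ⟨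
        superfactorial (p ℕ.+ q) * quotients n
          ≡⟨ ≡.cong (λ k → superfactorial k * quotients n) p+q≡n ⟩
        superfactorial n * quotients n ∎
        where
        p q : ℕ
        p = ⌈ n /2⌉
        q = ⌊ n /2⌋
        p+q≡n : p ℕ.+ q ≡ n
        p+q≡n = ≡.trans (ℕ.+-comm p q) (ℕ.⌊n/2⌋+⌈n/2⌉≡n n)
        hooks : Carrier
        hooks = ∏[ r < p ] ∏[ c < q ] hook (p ℕ.+ q) r c
        N D : ℕ → ℕ → Carrier
        N r c = T - S + fromℕ (suc c) - fromℕ (suc r)
        D r c = hook n r c
        row : ∀ r → r ℕ.< p → ∏[ c < q ] (N r c / D r c) * ∏ q (hook (p ℕ.+ q) r) ≈ ∏[ c < q ] ((T + fromℕ c) - (S + fromℕ r))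
        row r r<p = begin
          ∏[ c < q ] (N r c / D r c) * ∏ q (hook (p ℕ.+ q) r)
            ≡⟨ ≡.cong (λ k → ∏[ c < q ] (N r c / D r c) * ∏ q (hook k r)) p+q≡n ⟩
          ∏[ c < q ] (N r c / D r c) * ∏ q (D r)
            ≈⟨ ∏-/ q (N r) (D r) (λ c c<q e → let k , eq = hook≈ r<p c<q in
                 characteristic-0 k (trans (sym eq) (trans (reflexive (≡.cong (λ k →
                     hook k r c) p+q≡n)) e))) ⟩
          ∏ q (N r)
            ≈⟨ ∏-cong q (N r) (λ c → (T + fromℕ c) - (S + fromℕ r)) (λ c _ →
                 solve 4 (λ s t c r → t :- s :+ (con (+ 1) :+ c) :- (con (+ 1) :+ r)
                     := t :+ c :- (s :+ r)) refl S T (fromℕ c) (fromℕ r)) ⟩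
          ∏[ c < q ] ((T + fromℕ c) - (S + fromℕ r)) ∎
        quotients*hooks : quotients n * hooks ≈ cross p q S T
        quotients*hooks = trans
          (sym (∏-* p (λ r → ∏[ c < q ] (N r c / D r c)) (λ r → ∏ q (hook (p ℕ.+ q) r))))
          (∏-cong p (λ r → ∏[ c < q ] (N r c / D r c) * ∏ q (hook (p ℕ.+ q) r)) (λ r →
              ∏[ c < q ] ((T + fromℕ c) - (S + fromℕ r))) row)

      determinant : ∀ n → n ≥ 1 →
        det {n} (λ i j → a S T (2 ℕ.* toℕ i ℕ.+ toℕ j))
          ≈ (- 1#) ^ (⌈ n /2⌉ C 2)
            * ((∏[ i < n ] fromℕ ((2 ℕ.* i) !)) / fromℕ 2 ^ (n ℕ.* (n ∸ 1)))
            * (∏[ l < ⌈ n /2⌉ ] (pochhammer (S + ½) l / pochhammer (S + 1#) (n ∸ 1 ℕ.+ l)))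
            * (∏[ m < ⌊ n /2⌋ ] (pochhammer (T + ½) m / pochhammer (T + 1#) (n ∸ 1 ℕ.+ m)))
            * (∏[1≤ r ≤ ⌈ n /2⌉ ] ∏[1≤ c ≤ ⌊ n /2⌋ ]
                 ((T - S + fromℕ c - fromℕ r) / (fromℕ n - fromℕ r - fromℕ c + 1#)))
      determinant n@(suc N) _ = begin
        det {n} (λ i j → column (toℕ j) (toℕ i))
          ≈⟨ det-column N ⟩
        ∏ n (columnFactor N) * (∏ n rowFactor * V)
          ≈⟨ *-cong (∏-columnFactor N n) (*-congʳ (∏-* n ((- 1#) ^_) (pochhammer ½))) ⟩
        KS * KT * (E * H * V)
          -- The row signs `E` are moved next to `V`, since `differences-point` evaluates the two
          -- together.
          ≈⟨ solve 5 (λ x y e h v → x :* y :* (e :* h :* v) := x :* y :* (h :* (e :* v))) refl KS KT E H V ⟩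
        KS * KT * (H * (E * V))
          ≈⟨ *-congˡ (*-congˡ (trans (differences-point n S T) (*-congˡ (quotients-cross n)))) ⟩
        KS * KT * (H * (sgn n * (superfactorial n * quotients n)))
          ≈⟨ solve 6 (λ x y h g f q → x :* y :* (h :* (g :* (f :* q))) := g :* (f :* h) :* x :* y :* q) refl
               KS KT H (sgn n) (superfactorial n) (quotients n) ⟩
        sgn n * (superfactorial n * H) * KS * KT * quotients n
          ≈⟨ *-congʳ (*-congʳ (*-congʳ (*-congˡ (∏-[2i]! n)))) ⟩
        sgn n * (∏[ i < n ] fromℕ ((2 ℕ.* i) !) / fromℕ 2 ^ (n ℕ.* N)) * KS * KT * quotients n ∎
        where
        E H V KS KT : Carrier
        E = ∏[ i < n ] ((- 1#) ^ i)
        H = ∏ n (pochhammer ½)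
        V = differences {n} (point S T ∘ toℕ)
        KS = ∏[ l < ⌈ n /2⌉ ] (pochhammer (S + ½) l / pochhammer (S + 1#) (N ℕ.+ l))
        KT = ∏[ m < ⌊ n /2⌋ ] (pochhammer (T + ½) m / pochhammer (T + 1#) (N ℕ.+ m))

-- Nonvanishing of the denominators in ℚ(s,t).

module EmbeddedElements {c ℓ} (D : IntegralDomain c ℓ) where
  open IntegralDomain D hiding (zero)
  open Fractions D
  open RawMonoidOps +-rawMonoid using () renaming (_×_ to _•_)
  private module F = Field fractionField
  open OverField fractionField using (fromℕ)

  embed-+ : ∀ x y → embed x F.+ embed y F.≈ embed (x + y)
  embed-+ x y = mk≃ (*-cong (+-cong (*-identityʳ x) (*-identityʳ y)) (sym (*-identityʳ 1#)))

  fromℕ≈embed : ∀ n → fromℕ n F.≈ embed (n • 1#)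
  fromℕ≈embed zero    = F.refl
  fromℕ≈embed (suc n) = F.trans (F.+-congˡ {F.1#} (fromℕ≈embed n)) (embed-+ 1# (n • 1#))

  embed≉0 : ∀ {x y} → x F.≈ embed y → ¬ (y ≈ 0#) → ¬ (x F.≈ F.0#)
  embed≉0 {x} {y} e y≉0 x≈0 = y≉0 (≃0⇒num≈0 {embed y} (F.trans (F.sym {x} e) x≈0))

  -- A sum of fractions carries a product of denominators; rewriting it with denominator 1 reduces
  -- nonvanishing to a polynomial.
  1+fromℕ≈embed : ∀ x n → embed x F.+ F.1# F.+ fromℕ n F.≈ embed (x + 1# + n • 1#)
  1+fromℕ≈embed x n = F.trans (F.+-cong (embed-+ x 1#) (fromℕ≈embed n)) (embed-+ (x + 1#) (n • 1#))

module RationalFunctions where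
  module ℚ[s]ₚ = IntegralDomain ℚ[s]
  module Q = IntegralDomain ℚ[s][t]
  module F = Field ℚ⟨s,t⟩
  module Pℚ = Polynomials ℚ.+-*-commutativeRing
  module Pℚ[s] = Polynomials ℚ[s]ₚ.commutativeRing
  module Fr = Fractions ℚ[s][t]
  open EmbeddedElements ℚ[s][t]
  open OverField ℚ⟨s,t⟩ using (fromℕ)
  open RawMonoidOps Q.+-rawMonoid using () renaming (_×_ to _•_)

  -- The coefficient of sᵏtˡ; the outer variable is t.
  coefficient : ℕ → ℕ → Q.Carrier → ℚ
  coefficient k l p = Pℚ.coeff (Pℚ[s].coeff p l) k

  coefficient-cong : ∀ k l {p q} → p Q.≈ q → coefficient k l p ≡ coefficient k l q
  coefficient-cong k l e = Pℚ.at (Pℚ[s].at e l) k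

  coefficient-+ : ∀ k l p q → coefficient k l (p Q.+ q) ≡ coefficient k l p ℚ.+ coefficient k l q
  coefficient-+ k l p q
      = ≡.trans (Pℚ.at (Pℚ[s].coeff-⊕ p q l) k) (Pℚ.coeff-⊕ (Pℚ[s].coeff p l) (Pℚ[s].coeff q l) k)

  coefficient-× : ∀ k l n p → coefficient k l p ≡ 0ℚ → coefficient k l (n • p) ≡ 0ℚ
  coefficient-× k l zero    p e = ≡.refl
  coefficient-× k l (suc n) p e = ≡.trans (coefficient-+ k l p (n • p))
      (≡.cong₂ ℚ._+_ e (coefficient-× k l n p e))

  -- The order of ℚ yields characteristic 0: adding 1 repeatedly keeps the constant term positive.
  constant-positive : ∀ n → 0ℚ ℚ.< coefficient 0 0 (suc n • Q.1#)
  constant-positive zero    = ≡.subst (0ℚ ℚ.<_) (≡.sym (coefficient-+ 0 0 Q.1# Q.0#)) (ℚ.positive⁻¹ 1ℚ)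
  constant-positive (suc n) = ≡.subst (0ℚ ℚ.<_) (≡.sym (coefficient-+ 0 0 Q.1# (suc n • Q.1#)))
    (ℚ.+-mono-< (ℚ.positive⁻¹ 1ℚ) (constant-positive n))

  characteristic-0 : ∀ n → ¬ (fromℕ (suc n) F.≈ F.0#)
  characteristic-0 n = embed≉0 (fromℕ≈embed (suc n))
    λ e → ℚ.<-irrefl (≡.sym (coefficient-cong 0 0 e)) (constant-positive n)

  -- A single coefficient that is blind to constants detects x+1+n: that of s for `s`, and that of t
  -- for `t`.
  shift≉0 : ∀ k l x → coefficient k l Q.1# ≡ 0ℚ → coefficient k l x ≡ 1ℚ →
            ∀ n → ¬ (Fr.embed x F.+ F.1# F.+ fromℕ n F.≈ F.0#)
  shift≉0 k l x 1↦0 x↦1 n = embed≉0 (1+fromℕ≈embed x n)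
    λ e → contradiction (≡.trans (≡.sym value) (coefficient-cong k l e)) λ ()
    where
    value : coefficient k l (x Q.+ Q.1# Q.+ n • Q.1#) ≡ 1ℚ
    value = ≡.trans (coefficient-+ k l (x Q.+ Q.1#) (n • Q.1#))
      (≡.cong₂ ℚ._+_ (≡.trans (coefficient-+ k l x Q.1#)
          (≡.cong₂ ℚ._+_ x↦1 1↦0)) (coefficient-× k l n Q.1# 1↦0))

  s-regular : ∀ n → ¬ (s F.+ F.1# F.+ fromℕ n F.≈ F.0#)
  s-regular = shift≉0 1 0 (Fr.num s) ≡.refl ≡.refl

  t-regular : ∀ n → ¬ (t F.+ F.1# F.+ fromℕ n F.≈ F.0#)
  t-regular = shift≉0 0 1 (Fr.num t) ≡.refl ≡.refl

theorem23p1 :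
  let open Field ℚ⟨s,t⟩
      open OverField ℚ⟨s,t⟩
  in (n : ℕ) → n ≥ 1 →
     det {n} (λ i j → a s t (2 ℕ.* toℕ i ℕ.+ toℕ j))
       ≈ (- 1#) ^ (⌈ n /2⌉ C 2)
         * ((∏[ i < n ] fromℕ ((2 ℕ.* i) !)) / fromℕ 2 ^ (n ℕ.* (n ∸ 1)))
         * (∏[ l < ⌈ n /2⌉ ] (pochhammer (s + ½) l / pochhammer (s + 1#) (n ∸ 1 ℕ.+ l)))
         * (∏[ m < ⌊ n /2⌋ ] (pochhammer (t + ½) m / pochhammer (t + 1#) (n ∸ 1 ℕ.+ m)))
         * (∏[1≤ r ≤ ⌈ n /2⌉ ] ∏[1≤ c ≤ ⌊ n /2⌋ ]
              ((t - s + fromℕ c - fromℕ r) / (fromℕ n - fromℕ r - fromℕ c + 1#)))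
theorem23p1 =
  BesselDeterminant.determinant ℚ⟨s,t⟩ characteristic-0 s t s-regular t-regular
  where open RationalFunctions using (characteristic-0; s-regular; t-regular)
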